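{- Let $\mathbb{F}$ be a field, $n\ge1$, let $G$ be a nonempty finite subgraph of $\mathrm{Path}_{\mathbb Z}$ with no isolated vertices, and let $A:[n]^{D(G)}\to\mathbb{F}$. Then $\mathcal L_{\mathsf{sm}}(A^\flat)\ge n^{\log_2\ell(G)}\,\rho(A)$.
   Context: $\mathrm{Path}_{\mathbb Z}$ has vertices $v_i$ ($i\in\mathbb Z$) and edges $\{v_{i-1},v_i\}$. For such $G$: $V_1(G),V_2(G)$ are the vertices of degree $1$ and $2$ in $G$; $D(G)=\{vw:\{v,w\}\in E(G)\}$ is the set of directed edges; $D_1(G)=\{vw\in D(G):v\in V_1(G)\}$. For $S\subseteq V(\mathrm{Path}_{\mathbb Z})$, $\mathcal P(S)$ is the set of pairs $\gamma=(I_\gamma,J_\gamma)$ of disjoint sets of directed edges of $\mathrm{Path}_{\mathbb Z}$, each with tail in $S$, such that for every $v\in S$ with $\mathrm{Path}_{\mathbb Z}$-neighbours $u,w$, one of $vu,vw$ lies in $I_\gamma$ and the other in $J_\gamma$. For $A:[n]^{D(G)}\to\mathbb{F}$, $\alpha\in\mathcal P(V_2(G))$, $\gamma\in\mathcal P(V_1(G))$: $\mathrm{relrk}_{\alpha,\gamma}(A)=n^{ -|E(G)|}\mathrm{rank}\,\mathrm{Mat}_{I_\alpha\sqcup(I_\gamma\cap D_1(G)),\,J_\alpha\sqcup(J_\gamma\cap D_1(G))}(A)$, where $\mathrm{Mat}_{I,J}(A)$ is the flattening with rows indexed by $[n]^I$ and columns by $[n]^J$ (these two sets partition $D(G)$).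 Then $\rho(A)=\max_{\gamma\in\mathcal P(V_1(G))}\min\sum_{\alpha\in\mathcal P(V_2(G))}\mathrm{relrk}_{\alpha,\gamma}(X_\alpha)$, the minimum over families $X_\alpha:[n]^{D(G)}\to\mathbb{F}$ with $A=\sum_\alpha X_\alpha$. $A^\flat:[n^2]^{E(G)}\to\mathbb{F}$: $A^\flat(y)=A(x)$ where $y_{\{v_{i-1},v_i\}}=\langle x_{v_{i-1}v_i},x_{v_iv_{i-1}}\rangle$, with $\langle a,b\rangle=(a-1)n+b$. $\ell(G)$ is the maximal number of edges in a connected component of $G$. $\mathcal L_{\mathsf{sm}}$ of $B:[N]^D\to\mathbb{F}$ ($D$ finite nonempty): if $|D|=1$, it is $1$ if $B\ne0$, else $0$; if $|D|\ge2$, the minimum of $\sum_i(\mathcal L_{\mathsf{sm}}(B_i)+\mathcal L_{\mathsf{sm}}(C_i))$ over families with disjoint nonempty $E_i\cup F_i=D$, $B_i:[N]^{E_i}\to\mathbb{F}$, $C_i:[N]^{F_i}\to\mathbb{F}$, $B=\sum_iB_i\otimes C_i$. -}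

module Defs where

open import Level using (Level; 0ℓ; _⊔_; Lift)
open import Algebra.Apartness.Bundles using (HeytingField; HeytingCommutativeRing)
open import Algebra.Bundles using (CommutativeRing; RawMonoid)
import Algebra.Definitions.RawMonoid as RawMonoidDefs
open import Algebra.Definitions.RawSemiring using () renaming (_^_ to pow)
open import Data.Bool.Base using (Bool; true; false; not)
open import Data.Empty using (⊥; ⊥-elim)
open import Data.Fin.Base using (Fin; remQuot)
open import Data.Integer.Base using (ℤ; +_; pred) renaming (suc to sucℤ)
import Data.Integer.Properties as ℤ
open import Data.List.Base using (List; []; _∷_; _++_; length; filter; concatMap)
open import Data.List.Membership.Propositional using (_∈_; find)
open import Data.List.Membership.Propositional.Properties
  using (∈-filter⁺; ∈-filter⁻; ∈-concatMap⁻; ∈-++⁺ˡ; ∈-++⁺ʳ)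
open import Data.List.Relation.Ternary.Interleaving using (_∷ˡ_; _∷ʳ_; [])
open import Data.List.Relation.Ternary.Interleaving.Propositional using (Interleaving)
open import Data.List.Relation.Unary.All as All using (All; []; _∷_)
open import Data.List.Relation.Unary.Any using (here; there)
open import Data.List.Relation.Unary.AllPairs using ([]; _∷_)
open import Data.List.Relation.Unary.Unique.Propositional using (Unique)
open import Data.List.Relation.Unary.Unique.Propositional.Properties using (filter⁺)
open import Data.Nat.Base as ℕ using (ℕ; zero; suc; NonZero)
import Data.Nat.Properties as ℕ
open import Data.Product.Base using (Σ; ∃-syntax; _×_; _,_; proj₁; proj₂)
open import Data.Product.Properties using (≡-dec)
open import Data.Rational.Base as ℚ using (ℚ)
open import Data.Sum.Base using (_⊎_; inj₁; inj₂; [_,_]′)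
open import Function.Base using (_∘_)
open import Function.Bundles using (_⇔_; mk⇔)
open import Relation.Binary.Core using (Rel)
open import Relation.Binary.Construct.Closure.ReflexiveTransitive using (Star)
import Relation.Binary.PropositionalEquality as ≡
open import Relation.Binary.PropositionalEquality
  using (_≡_; _≢_; refl; sym; trans; cong)
open import Relation.Nullary using (¬_; Dec)
open import Relation.Nullary.Decidable using (_⊎-dec_)
open import Relation.Unary using (Pred)

-- Minima over infinite families, and ranks over a field
-- without decidable equality, are not computable, so the numerical
-- invariants below are given by their graphs: `IsX … m` says `X … = m`.

module _ {a ℓ p : Level} {A : Set a} (_≤_ : Rel A ℓ) (P : Pred A p) where

  IsMinimum : Pred A (a ⊔ ℓ ⊔ p)
  IsMinimum m = P m × (∀ k → P k → m ≤ k)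

  IsMaximum : Pred A (a ⊔ ℓ ⊔ p)
  IsMaximum m = P m × (∀ k → P k → k ≤ m)

-- The real number inequality  n ^ (log₂ l) · r ≤ L  for l ≥ 1, n ≥ 1, r ≥ 0.
-- As n ≥ 1, n ^ (log₂ l) is the supremum of n ^ (p / q) over the rationals
-- 0 ≤ p / q ≤ log₂ l, where p / q ≤ log₂ l means 2 ^ p ≤ l ^ q; and
-- n ^ (p / q) · r ≤ L means n ^ p · r ^ q ≤ L ^ q.

fromℕ : ℕ → ℚ
fromℕ k = + k ℚ./ 1

_^ℚ_ : ℚ → ℕ → ℚ
_^ℚ_ = pow ℚ.+-*-rawSemiring

_^log₂_·_≼_ : ℕ → ℕ → ℚ → ℕ → Set
n ^log₂ l · r ≼ L =
  ∀ p q → .{{NonZero q}} → 2 ℕ.^ p ℕ.≤ l ℕ.^ q →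
  fromℕ (n ℕ.^ p) ℚ.* (r ^ℚ q) ℚ.≤ fromℕ L ^ℚ q

-- i : ℤ is the vertex v_i.
Vertex : Set
Vertex = ℤ

-- i : ℤ is the edge {v_{i-1} , v_i}.
Edge : Set
Edge = ℤ

-- (v , w) is the directed edge vw.
DEdge : Set
DEdge = Vertex × Vertex

_≟ᵈ_ : (d e : DEdge) → Dec (d ≡ e)
_≟ᵈ_ = ≡-dec ℤ._≟_ ℤ._≟_

open import Data.List.Membership.DecPropositional ℤ._≟_ using () renaming (_∈?_ to _∈ᵛ?_)
open import Data.List.Membership.DecPropositional _≟ᵈ_ using () renaming (_∈?_ to _∈ᵈ?_)

-- Finite sets are duplicate-free lists.
record Subgraph : Set where
  field
    V    : List Vertex
    V!   : Unique V
    E    : List Edge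
    E!   : Unique E
    ends : ∀ {i} → i ∈ E → pred i ∈ V × i ∈ V

Incident : Vertex → Edge → Set
Incident v i = v ≡ pred i ⊎ v ≡ i

incident? : ∀ v i → Dec (Incident v i)
incident? v i = (v ℤ.≟ pred i) ⊎-dec (v ℤ.≟ i)

directions : Edge → List DEdge
directions i = (pred i , i) ∷ (i , pred i) ∷ []

-- Every edge of Path_ℤ leaving v is `toward v true` or `toward v false`.
toward : Vertex → Bool → DEdge
toward v true  = v , sucℤ v
toward v false = v , pred v

module _ (G : Subgraph) where
  open Subgraph G

  degree : Vertex → ℕ
  degree v = length (filter (incident? v) E)

  NoIsolatedVertices : Set
  NoIsolatedVertices = ∀ {v} → v ∈ V → degree v ≢ 0

  V₁ V₂ : List Vertex
  V₁ = filter (λ v → degree v ℕ.≟ 1) V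
  V₂ = filter (λ v → degree v ℕ.≟ 2) V

  D D₁ : List DEdge
  D  = concatMap directions E
  D₁ = filter (λ d → proj₁ d ∈ᵛ? V₁) D

  Connected : Vertex → Vertex → Set
  Connected = Star (λ v w → (v , w) ∈ D)

  -- C lists the edges of the connected component of v (an edge lies in the
  -- component as soon as one of its endpoints does).
  IsComponentEdges : Vertex → List Edge → Set
  IsComponentEdges v C = Unique C × (∀ i → i ∈ C ⇔ (i ∈ E × Connected v i))

  Isℓ : ℕ → Set
  Isℓ = IsMaximum ℕ._≤_ λ k →
    ∃[ v ] ∃[ C ] v ∈ V × IsComponentEdges v C × length C ≡ k

-- An element γ of 𝒫(S) is determined by telling, for each v ∈ S,
-- which of the two edges leaving v lies in I γ (the other lies in J γ).
-- `𝒫-sound` and `𝒫-complete` compare this with the description as pairs of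
-- sets of directed edges.

𝒫 : List Vertex → Set
𝒫 S = All (λ _ → Bool) S

I J : ∀ {S} → 𝒫 S → List DEdge
I []            = []
I {v ∷ _} (b ∷ γ) = toward v b ∷ I γ
J []            = []
J {v ∷ _} (b ∷ γ) = toward v (not b) ∷ J γ

record IsSplitting (S : List Vertex) (P Q : Pred DEdge 0ℓ) : Set where
  field
    disjoint : ∀ {d} → P d → Q d → ⊥
    edges    : ∀ {d} → P d ⊎ Q d → ∃[ v ] ∃[ b ] v ∈ S × d ≡ toward v b
    splits   : ∀ {v} → v ∈ S → ∃[ b ] P (toward v b) × Q (toward v (not b))

toward-tail : ∀ v b → proj₁ (toward v b) ≡ v
toward-tail v true  = refl
toward-tail v false = refl

pred≢suc : ∀ v → pred v ≢ sucℤ v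
pred≢suc v = ℤ.<⇒≢ (ℤ.<-trans (ℤ.i≤pred[j]⇒i<j {j = v} ℤ.≤-refl) (ℤ.suc[i]≤j⇒i<j {v} ℤ.≤-refl))

toward-not : ∀ v b → toward v b ≢ toward v (not b)
toward-not v true  eq = pred≢suc v (sym (cong proj₂ eq))
toward-not v false eq = pred≢suc v (cong proj₂ eq)

I⁻ : ∀ {S} (γ : 𝒫 S) {d} → d ∈ I γ → ∃[ v ] Σ (v ∈ S) λ v∈S → d ≡ toward v (All.lookup γ v∈S)
I⁻ (b ∷ γ) (here eq)  = _ , here refl , eq
I⁻ (b ∷ γ) (there d∈) with _ , v∈S , eq ← I⁻ γ d∈ = _ , there v∈S , eq

J⁻ : ∀ {S} (γ : 𝒫 S) {d} → d ∈ J γ → ∃[ v ] Σ (v ∈ S) λ v∈S → d ≡ toward v (not (All.lookup γ v∈S))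
J⁻ (b ∷ γ) (here eq)  = _ , here refl , eq
J⁻ (b ∷ γ) (there d∈) with _ , v∈S , eq ← J⁻ γ d∈ = _ , there v∈S , eq

I⁺ : ∀ {S} (γ : 𝒫 S) {v} (v∈S : v ∈ S) → toward v (All.lookup γ v∈S) ∈ I γ
I⁺ (b ∷ γ) (here refl) = here refl
I⁺ (b ∷ γ) (there v∈S) = there (I⁺ γ v∈S)

J⁺ : ∀ {S} (γ : 𝒫 S) {v} (v∈S : v ∈ S) → toward v (not (All.lookup γ v∈S)) ∈ J γ
J⁺ (b ∷ γ) (here refl) = here refl
J⁺ (b ∷ γ) (there v∈S) = there (J⁺ γ v∈S)

I∪J⁺ : ∀ {S} (γ : 𝒫 S) {v} b → v ∈ S → toward v b ∈ I γ ⊎ toward v b ∈ J γ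
I∪J⁺ γ b v∈S with All.lookup γ v∈S | I⁺ γ v∈S | J⁺ γ v∈S
I∪J⁺ γ true  v∈S | true  | i | j = inj₁ i
I∪J⁺ γ true  v∈S | false | i | j = inj₂ j
I∪J⁺ γ false v∈S | true  | i | j = inj₂ j
I∪J⁺ γ false v∈S | false | i | j = inj₁ i

I∩J : ∀ {S} → Unique S → (γ : 𝒫 S) → ∀ {d} → d ∈ I γ → d ∈ J γ → ⊥
I∩J (_ ∷ _)   (b ∷ γ) (here refl) (here eq) = toward-not _ b eq
I∩J (v∉S ∷ _) (b ∷ γ) (here refl) (there j) with v , v∈S , eq ← J⁻ γ j =
  All.lookup v∉S v∈S (trans (sym (toward-tail _ b))
    (trans (cong proj₁ eq) (toward-tail v (not (All.lookup γ v∈S)))))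
I∩J (v∉S ∷ _) (b ∷ γ) (there i) (here refl) with v , v∈S , eq ← I⁻ γ i =
  All.lookup v∉S v∈S (trans (sym (toward-tail _ (not b)))
    (trans (cong proj₁ eq) (toward-tail v (All.lookup γ v∈S))))
I∩J (_ ∷ S!)  (b ∷ γ) (there i) (there j) = I∩J S! γ i j

𝒫-sound : ∀ {S} → Unique S → (γ : 𝒫 S) → IsSplitting S (_∈ I γ) (_∈ J γ)
𝒫-sound S! γ = record
  { disjoint = I∩J S! γ
  ; edges    = λ { (inj₁ i) → let v , v∈S , eq = I⁻ γ i in v , _ , v∈S , eq
                 ; (inj₂ j) → let v , v∈S , eq = J⁻ γ j in v , _ , v∈S , eq }
  ; splits   = λ v∈S → All.lookup γ v∈S , I⁺ γ v∈S , J⁺ γ v∈S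
  }

lookup-tabulate : ∀ {S : List Vertex} (f : ∀ {v} → v ∈ S → Bool) {v} (v∈S : v ∈ S) →
                  All.lookup (All.tabulate f) v∈S ≡ f v∈S
lookup-tabulate f (here refl) = refl
lookup-tabulate f (there v∈S) = lookup-tabulate (f ∘ there) v∈S

𝒫-complete : ∀ {S P Q} → IsSplitting S P Q →
  Σ (𝒫 S) λ γ → ∀ d → (P d ⇔ d ∈ I γ) × (Q d ⇔ d ∈ J γ)
𝒫-complete {S} {P} {Q} PQ = γ , λ d → mk⇔ P⇒I I⇒P , mk⇔ Q⇒J J⇒Q
  where
  open IsSplitting PQ

  γ : 𝒫 S
  γ = All.tabulate (λ v∈S → proj₁ (splits v∈S))

  spec : ∀ {v} (v∈S : v ∈ S) →
         P (toward v (All.lookup γ v∈S)) × Q (toward v (not (All.lookup γ v∈S)))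
  spec v∈S rewrite lookup-tabulate (λ v∈S → proj₁ (splits v∈S)) v∈S = proj₂ (splits v∈S)

  I⇒P : ∀ {d} → d ∈ I γ → P d
  I⇒P i with _ , v∈S , refl ← I⁻ γ i = proj₁ (spec v∈S)

  J⇒Q : ∀ {d} → d ∈ J γ → Q d
  J⇒Q j with _ , v∈S , refl ← J⁻ γ j = proj₂ (spec v∈S)

  P⇒I : ∀ {d} → P d → d ∈ I γ
  P⇒I p with v , b , v∈S , refl ← edges (inj₁ p) with I∪J⁺ γ b v∈S
  ... | inj₁ i = i
  ... | inj₂ j = ⊥-elim (disjoint p (J⇒Q j))

  Q⇒J : ∀ {d} → Q d → d ∈ J γ
  Q⇒J q with v , b , v∈S , refl ← edges (inj₂ q) with I∪J⁺ γ b v∈S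
  ... | inj₁ i = ⊥-elim (disjoint (I⇒P i) q)
  ... | inj₂ j = j

module _ {c ℓ : Level} (M : RawMonoid c ℓ) where
  open RawMonoid M

  sum𝒫 : ∀ {S} → (𝒫 S → Carrier) → Carrier
  sum𝒫 {[]}    f = f []
  sum𝒫 {_ ∷ _} f = sum𝒫 (λ γ → f (true ∷ γ)) ∙ sum𝒫 (λ γ → f (false ∷ γ))

module _ (G : Subgraph) where
  open Subgraph G

  rowEdges colEdges : 𝒫 (V₂ G) → 𝒫 (V₁ G) → List DEdge
  rowEdges α γ = I α ++ filter (_∈ᵈ? D₁ G) (I γ)
  colEdges α γ = J α ++ filter (_∈ᵈ? D₁ G) (J γ)

  degree≢0 : ∀ {v i} → i ∈ E → Incident v i → degree G v ≢ 0
  degree≢0 {v} {i} i∈E vi eq with filter (incident? v) E | ∈-filter⁺ (incident? v) i∈E vi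
  degree≢0 i∈E vi () | _ ∷ _ | _

  degree≤2 : ∀ v → degree G v ℕ.≤ 2
  degree≤2 v = ≤2 _ (filter⁺ (incident? v) E!) (λ i∈ → endpoint (proj₂ (∈-filter⁻ (incident? v) {xs = E} i∈)))
    where
    endpoint : ∀ {i} → Incident v i → i ≡ sucℤ v ⊎ i ≡ v
    endpoint {i} (inj₁ eq) = inj₁ (trans (sym (ℤ.suc-pred i)) (cong sucℤ (sym eq)))
    endpoint     (inj₂ eq) = inj₂ (sym eq)

    ≤2 : ∀ {a b : ℤ} xs → Unique xs → (∀ {x} → x ∈ xs → x ≡ a ⊎ x ≡ b) → length xs ℕ.≤ 2
    ≤2 []          _ _ = ℕ.z≤n
    ≤2 (_ ∷ [])    _ _ = ℕ.s≤s ℕ.z≤n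
    ≤2 (_ ∷ _ ∷ []) _ _ = ℕ.s≤s (ℕ.s≤s ℕ.z≤n)
    ≤2 (x ∷ y ∷ z ∷ _) ((x≢y ∷ x≢z ∷ _) ∷ (y≢z ∷ _) ∷ _) h
      with h (here refl) | h (there (here refl)) | h (there (there (here refl)))
    ... | inj₁ refl | inj₁ refl | _         = ⊥-elim (x≢y refl)
    ... | inj₂ refl | inj₂ refl | _         = ⊥-elim (x≢y refl)
    ... | inj₁ refl | inj₂ refl | inj₁ refl = ⊥-elim (x≢z refl)
    ... | inj₁ refl | inj₂ refl | inj₂ refl = ⊥-elim (y≢z refl)
    ... | inj₂ refl | inj₁ refl | inj₁ refl = ⊥-elim (y≢z refl)
    ... | inj₂ refl | inj₁ refl | inj₂ refl = ⊥-elim (x≢z refl)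

  D⁻ : ∀ {d} → d ∈ D G → ∃[ v ] ∃[ b ] d ≡ toward v b × ∃[ i ] i ∈ E × v ∈ V × Incident v i
  D⁻ d∈D with find (∈-concatMap⁻ directions {xs = E} d∈D)
  ... | i , i∈E , here refl =
    pred i , true , cong (pred i ,_) (sym (ℤ.suc-pred i)) , i , i∈E , proj₁ (ends i∈E) , inj₁ refl
  ... | i , i∈E , there (here refl) =
    i , false , refl , i , i∈E , proj₂ (ends i∈E) , inj₂ refl

  cover : ∀ α γ {d} → d ∈ D G → d ∈ rowEdges α γ ⊎ d ∈ colEdges α γ
  cover α γ d∈D with v , b , refl , i , i∈E , v∈V , vi ← D⁻ d∈D
    with degree G v in eq | degree≤2 v | degree≢0 i∈E vi
  ... | 0 | _ | ≢0 = ⊥-elim (≢0 refl)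
  ... | 1 | _ | _ = go (I∪J⁺ γ b v∈V₁)
    where
    v∈V₁ : v ∈ V₁ G
    v∈V₁ = ∈-filter⁺ (λ v → degree G v ℕ.≟ 1) v∈V eq
    d∈D₁ : toward v b ∈ D₁ G
    d∈D₁ = ∈-filter⁺ (λ d → proj₁ d ∈ᵛ? V₁ G) d∈D (≡.subst (_∈ V₁ G) (sym (toward-tail v b)) v∈V₁)
    go : toward v b ∈ I γ ⊎ toward v b ∈ J γ →
         toward v b ∈ rowEdges α γ ⊎ toward v b ∈ colEdges α γ
    go (inj₁ i) = inj₁ (∈-++⁺ʳ (I α) (∈-filter⁺ (_∈ᵈ? D₁ G) i d∈D₁))
    go (inj₂ j) = inj₂ (∈-++⁺ʳ (J α) (∈-filter⁺ (_∈ᵈ? D₁ G) j d∈D₁))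
  ... | 2 | _ | _ with I∪J⁺ α b (∈-filter⁺ (λ v → degree G v ℕ.≟ 2) v∈V eq)
  ...   | inj₁ i = inj₁ (∈-++⁺ˡ i)
  ...   | inj₂ j = inj₂ (∈-++⁺ˡ j)
  cover α γ d∈D | suc (suc (suc _)) | ℕ.s≤s (ℕ.s≤s ()) | _

-- [N]^X for a finite set X.
Assignment : {A : Set} → ℕ → List A → Set
Assignment N X = All (λ _ → Fin N) X

-- An interleaving of X and Y into Z exhibits Z as the disjoint union X ⊔ Y.
restrictˡ : ∀ {A : Set} {N} {X Y Z : List A} →
            Interleaving X Y Z → Assignment N Z → Assignment N X
restrictˡ []            []      = []
restrictˡ (refl ∷ˡ s) (a ∷ z) = a ∷ restrictˡ s z
restrictˡ (refl ∷ʳ s) (a ∷ z) = restrictˡ s z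

restrictʳ : ∀ {A : Set} {N} {X Y Z : List A} →
            Interleaving X Y Z → Assignment N Z → Assignment N Y
restrictʳ []            []      = []
restrictʳ (refl ∷ˡ s) (a ∷ z) = restrictʳ s z
restrictʳ (refl ∷ʳ s) (a ∷ z) = a ∷ restrictʳ s z

-- Inverse of y_{v_{i-1},v_i} = ⟨ x_{v_{i-1} v_i} , x_{v_i v_{i-1}} ⟩; for the
-- 0-based Fin, ⟨ a , b ⟩ = a n + b, which is `combine`, with inverse `remQuot`.
unpair : ∀ {n} {E : List Edge} →
         Assignment (n ℕ.* n) E → Assignment n (concatMap directions E)
unpair                 []      = []
unpair {n} {i ∷ E} (y ∷ ys) =
  proj₁ (remQuot {n} n y) ∷ proj₂ (remQuot {n} n y) ∷ unpair ys

module _ {c ℓ₁ ℓ₂ : Level} (F : HeytingField c ℓ₁ ℓ₂) where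
  open HeytingField F using (Carrier; _≈_; _*_; 0#; heytingCommutativeRing)
  open CommutativeRing (HeytingCommutativeRing.commutativeRing heytingCommutativeRing)
    using (+-rawMonoid)
  open RawMonoidDefs +-rawMonoid using (sum)
  open RawMonoidDefs ℕ.+-0-rawMonoid using () renaming (sum to sumℕ)

  Tensor : {A : Set} → ℕ → List A → Set c
  Tensor N X = Assignment N X → Carrier

  IsIndependent : {R : Set} {r : ℕ} → (Fin r → R → Carrier) → Set (c ⊔ ℓ₁)
  IsIndependent {r = r} u = (a : Fin r → Carrier) →
    (∀ i → sum (λ j → a j * u j i) ≈ 0#) → ∀ j → a j ≈ 0#

  IsRank : {R C : Set} → (R → C → Carrier) → ℕ → Set (c ⊔ ℓ₁)
  IsRank {C = C} M = IsMaximum ℕ._≤_ λ r →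
    Σ (Fin r → C) λ cols → IsIndependent (λ j i → M i (cols j))

  -- When X and Y are disjoint, the choice made by `cov` is forced.
  Mat : ∀ {A : Set} {n} {D : List A} (X Y : List A) →
        (∀ {d} → d ∈ D → d ∈ X ⊎ d ∈ Y) →
        Tensor n D → Assignment n X → Assignment n Y → Carrier
  Mat X Y cov B x y =
    B (All.tabulate (λ d∈D → [ All.lookup x , All.lookup y ]′ (cov d∈D)))

  module _ {n : ℕ} .{{_ : NonZero n}} (G : Subgraph) where
    open Subgraph G

    IsRelrk : 𝒫 (V₂ G) → 𝒫 (V₁ G) → Tensor n (D G) → ℚ → Set (c ⊔ ℓ₁)
    IsRelrk α γ B q = ∃[ r ]
      IsRank (Mat (rowEdges G α γ) (colEdges G α γ) (cover G α γ) B) r ×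
      q ≡ (+ r ℚ./ (n ℕ.^ length E)) {{ℕ.m^n≢0 n (length E)}}

    IsRelrkSum : 𝒫 (V₁ G) → Tensor n (D G) → ℚ → Set (c ⊔ ℓ₁)
    IsRelrkSum γ B s =
      Σ (𝒫 (V₂ G) → Tensor n (D G)) λ X → Σ (𝒫 (V₂ G) → ℚ) λ q →
        (∀ x → B x ≈ sum𝒫 +-rawMonoid (λ α → X α x)) ×
        (∀ α → IsRelrk α γ (X α) (q α)) ×
        s ≡ sum𝒫 ℚ.+-0-rawMonoid q

    Isρ : Tensor n (D G) → ℚ → Set (c ⊔ ℓ₁)
    Isρ B = IsMaximum ℚ._≤_ λ m → ∃[ γ ] IsMinimum ℚ._≤_ (IsRelrkSum γ B) m

    flat : Tensor n (D G) → Tensor (n ℕ.* n) E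
    flat B y = B (unpair y)

  record Term {A : Set} (N : ℕ) (D : List A) : Set c where
    field
      {X Y} : List A
      split : Interleaving X Y D
      X≢[]  : X ≢ []
      Y≢[]  : Y ≢ []
      left  : Tensor N X
      right : Tensor N Y

    value : Tensor N D
    value x = left (restrictˡ split x) * right (restrictʳ split x)

  module _ {A : Set} {N : ℕ} where
    open Term

    IsDecompositionSum : (∀ {D : List A} → Tensor N D → ℕ → Set (c ⊔ ℓ₁)) →
                         {D : List A} → Tensor N D → ℕ → Set (c ⊔ ℓ₁)
    IsDecompositionSum IsL {D} B s =
      ∃[ k ] Σ (Fin k → Term N D) λ t → Σ (Fin k → ℕ) λ l → Σ (Fin k → ℕ) λ r →
        (∀ x → B x ≈ sum (λ i → value (t i) x)) ×
        (∀ i → IsL (left (t i)) (l i) × IsL (right (t i)) (r i)) ×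
        s ≡ sumℕ (λ i → l i ℕ.+ r i)

    -- The recursion is on a bound for |D|, which decreases since X and Y are
    -- proper sublists of D.  The value is left undefined for D empty.
    IsLsm≤ : ℕ → {D : List A} → Tensor N D → ℕ → Set (c ⊔ ℓ₁)
    IsLsm≤ zero                      B m = Lift (c ⊔ ℓ₁) ⊥
    IsLsm≤ (suc k) {[]}              B m = Lift (c ⊔ ℓ₁) ⊥
    IsLsm≤ (suc k) {_ ∷ []}          B m =
      Lift c ((¬ (∀ x → B x ≈ 0#) × m ≡ 1) ⊎ ((∀ x → B x ≈ 0#) × m ≡ 0))
    IsLsm≤ (suc k) {_ ∷ _ ∷ _} B m =
      IsMinimum ℕ._≤_ (IsDecompositionSum (IsLsm≤ k) B) m

    IsLsm : {D : List A} → Tensor N D → ℕ → Set (c ⊔ ℓ₁)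
    IsLsm {D} = IsLsm≤ (length D)

{-# OPTIONS --safe #-}

-- A formula for A♭ is unfolded along one branch below each gate: at a product
-- B ⊗ C one descends into the factor that contains more edges of a longest
-- component and keeps the other factor as it is.  Colouring every kept factor
-- with one of two colours writes A♭ as a sum of at most L products f · g, where
-- f and g read the edges of the two colours.  The colours can be chosen such
-- that at least log₂ ℓ interior vertices of the component are cut, i.e. lie
-- between edges of different colours: merging the kept factor into one vertex of
-- colour c turns the tree of adjacencies into a signed tree on the edges
-- descended into, and a suitable c satisfies one further adjacency, while the
-- number of edges at most halves.
--
-- For such a product let the edges leaving a cut vertex go into columns if they
-- are read by f and into rows if they are read by g.  Summing over the row
-- coordinates of f and the column coordinates of g bounds the rank by
-- n ^ (|E| - number of cut vertices), after exchanging f and g if necessary: the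
-- exponents for the two choices add up to 2 (|E| - number of cut vertices).
-- Adding up the products gives n ^ ⌈log₂ ℓ⌉ · ρ ≤ L.
--
-- Ranks over F exist only up to double negation, which is enough because the
-- conclusion is a decidable inequality of rationals.

module Submission where

open import Defs
open import Algebra.Apartness.Bundles using (HeytingField; HeytingCommutativeRing)
import Algebra.Apartness.Properties.HeytingCommutativeRing as HeytingProperties
open import Algebra.Bundles using (CommutativeMonoid; CommutativeRing)
import Algebra.Definitions.RawMonoid as RawMonoidDefs
import Algebra.Properties.CommutativeSemigroup as CommutativeSemigroupProperties
import Algebra.Properties.Ring as RingProperties
import Algebra.Properties.Semiring.Sum as SemiringSum
open import Data.Bool.Base using (Bool; true; false; not; if_then_else_; _xor_)
import Data.Bool.Properties as Bool
open import Data.Empty using (⊥; ⊥-elim)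
open import Data.Fin.Base as Fin using (Fin; punchIn; combine)
import Data.Fin.Properties as Fin
open import Data.Integer.Base as ℤ using (+_; pred) renaming (suc to sucℤ)
import Data.Integer.Properties as ℤ
open import Data.List.Base using (List; []; _∷_; _++_; length; map; filter; concatMap)
open import Data.List.Membership.DecPropositional ℤ._≟_ using (_∈?_)
open import Data.List.Membership.Propositional using (_∈_; _∉_; find)
open import Data.List.Membership.Propositional.Properties
  using (∈-∃++; ∈-++⁻; ∈-concatMap⁻; ∈-filter⁺; ∈-filter⁻)
open import Data.List.Properties using (filter-accept; filter-reject; filter-all; length-++; length-map)
open import Data.List.Relation.Binary.Permutation.Propositional.Properties using (shift; map⁺; ∈-resp-↭)
open import Data.List.Relation.Binary.Subset.Propositional using (_⊆_)
open import Data.List.Relation.Ternary.Interleaving using (_∷ˡ_; _∷ʳ_; [])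
open import Data.List.Relation.Ternary.Interleaving.Propositional using (Interleaving)
open import Data.List.Relation.Unary.All as All using (All; []; _∷_)
import Data.List.Relation.Unary.All.Properties as All
open import Data.List.Relation.Unary.AllPairs using ([]; _∷_)
open import Data.List.Relation.Unary.Any using (here; there)
open import Data.List.Relation.Unary.Unique.Propositional using (Unique)
import Data.List.Relation.Unary.Unique.Propositional.Properties as Unique
open import Data.Nat.Base as ℕ using (ℕ; zero; suc; NonZero; _≤_; _<_; _^_; z≤n; s≤s)
import Data.Nat.ListAction as ℕ
import Data.Nat.ListAction.Properties as ℕ
import Data.Nat.Properties as ℕ
open import Data.Nat.Solver using (module +-*-Solver)
open import Data.Product.Base using (Σ; ∃-syntax; _×_; _,_; proj₁; proj₂)
open import Data.Rational.Base as ℚ using (ℚ; 0ℚ; 1ℚ)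
import Data.Rational.Properties as ℚ
open import Data.Rational.Unnormalised.Base as ℚᵘ using (mkℚᵘ)
import Data.Rational.Unnormalised.Properties as ℚᵘ
open import Data.Sum.Base as Sum using (_⊎_; inj₁; inj₂; [_,_]′)
open import Data.Unit.Base using (⊤; tt)
open import Data.Vec.Functional using (insertAt)
open import Data.Vec.Functional.Properties using (insertAt-lookup; insertAt-punchIn)
open import Function.Base using (_∘_; const)
open import Function.Bundles using (Equivalence)
open import Level using (Level; _⊔_; lift)
open import Relation.Binary.Construct.Closure.ReflexiveTransitive as Star using (_◅_)
open import Relation.Binary.PropositionalEquality
  using (_≡_; _≢_; refl; sym; trans; cong; cong₂; subst; subst₂)
open import Relation.Nullary using (¬_; yes; no; does; contradiction)
open import Relation.Nullary.Decidable using (dec-true; dec-false; decidable-stable; ¬¬-excluded-middle)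

-- Signed trees

bit : Bool → ℕ
bit b = if b then 1 else 0

-- The two equations solve the condition on an edge that leaves a contracted part for the colour of
-- that part: here the parent of the new vertex is contracted, in `xor-solve′` the new vertex
-- itself.
xor-solve : ∀ a c → a xor ((a xor not c) xor c) ≡ true
xor-solve false false = refl
xor-solve false true  = refl
xor-solve true  false = refl
xor-solve true  true  = refl

xor-solve′ : ∀ a c → (a xor not c) xor (a xor c) ≡ true
xor-solve′ false false = refl
xor-solve′ false true  = refl
xor-solve′ true  false = refl
xor-solve′ true  true  = refl

module _ {A : Set} where

  -- A spanning tree on Y, built by attaching vertices one at a time, whose
  -- edges carry signs: an edge yp with sign σ asks for s y xor s p xor σ, so
  -- σ = false asks for different colours and σ = true for equal ones.
  data SignedTree : List A → Set where
    root : ∀ y → SignedTree (y ∷ [])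
    link : ∀ y {p Y} → p ∈ Y → (σ : Bool) → SignedTree Y → SignedTree (y ∷ Y)

  satisfied : ∀ {Y} → SignedTree Y → (A → Bool) → ℕ
  satisfied (root y)           s = 0
  satisfied (link y {p} _ σ t) s = bit (s y xor (s p xor σ)) ℕ.+ satisfied t s

  satisfied-cong : ∀ {Y} (t : SignedTree Y) {s s′ : A → Bool} →
                   All (λ y → s y ≡ s′ y) Y → satisfied t s ≡ satisfied t s′
  satisfied-cong (root y)        _        = refl
  satisfied-cong (link y p∈ σ t) (e ∷ es) = cong₂ ℕ._+_
    (cong₂ (λ a b → bit (a xor (b xor σ))) e (All.lookup es p∈)) (satisfied-cong t es)

  satisfied-not : ∀ {Y} (t : SignedTree Y) (s : A → Bool) →
                  satisfied t (not ∘ s) ≡ satisfied t s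
  satisfied-not (root y)           s = refl
  satisfied-not (link y {p} _ σ t) s = cong₂ ℕ._+_ (cong bit (flip (s y) (s p))) (satisfied-not t s)
    where
    flip : ∀ a b → not a xor (not b xor σ) ≡ a xor (b xor σ)
    flip false false = Bool.not-involutive σ
    flip false true  = refl
    flip true  false = refl
    flip true  true  = sym (Bool.not-involutive σ)

  module _ (q : A → Bool) where

    side : Bool → List A → List A
    side b = filter (λ y → q y Bool.≟ b)

    length-sides : ∀ b Y → length (side b Y) ℕ.+ length (side (not b) Y) ≡ length Y
    length-sides b [] = refl
    length-sides b (y ∷ Y) with q y | b | length-sides b Y
    ... | false | false | eq = cong suc eq
    ... | true  | true  | eq = cong suc eq
    ... | false | true  | eq = trans (ℕ.+-suc _ _) (cong suc eq)
    ... | true  | false | eq = trans (ℕ.+-suc _ _) (cong suc eq)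

    extend : Bool → (A → Bool) → Bool → A → Bool
    extend b s c y = if does (q y Bool.≟ b) then s y else c

    extend-on : ∀ {b} s c {y} → q y ≡ b → extend b s c y ≡ s y
    extend-on {b} s c {y} eq rewrite dec-true (q y Bool.≟ b) eq = refl

    extend-off : ∀ {b} s c {y} → q y ≢ b → extend b s c y ≡ c
    extend-off {b} s c {y} ne rewrite dec-false (q y Bool.≟ b) ne = refl

    -- Contracting the vertices of t off side b to one vertex of colour c leaves
    -- conditions c = s x xor σ at some vertices x of side b.  One of them, at
    -- the anchor, is used to choose c, and the others become edges to the
    -- anchor.
    record Contraction {Y : List A} (t : SignedTree Y) (b : Bool) : Set where
      field
        {Y′}   : List A
        Y′≡    : Y′ ≡ side b Y
        tree   : SignedTree Y′
        {x}    : A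
        x∈Y′   : x ∈ Y′
        σ      : Bool
      colour : (A → Bool) → Bool
      colour s = s x xor σ
      field
        gain   : ∀ s → suc (satisfied tree s) ≤ satisfied t (extend b s (colour s))

    open Contraction

    -- The first link that joins the two sides supplies the anchor on each side and the condition
    -- solved by `colour`. A later vertex of side `b` stays linked to its parent, or is linked to
    -- the anchor if its parent is contracted; the conditions of later vertices off side `b` are
    -- given up.
    contract : ∀ {Y} (t : SignedTree Y) →
               (∃[ b ] All (λ y → q y ≡ b) Y) ⊎ (∀ b → Contraction t b)
    contract (root y) = inj₁ (q y , refl ∷ [])
    contract {y ∷ Y} (link y {p} p∈ σ₀ t) with contract t
    ... | inj₁ (b₀ , all) with q y Bool.≟ b₀
    ...   | yes eq = inj₁ (b₀ , eq ∷ all)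
    ...   | no y∉  = inj₂ new
      where
      new : ∀ b → Contraction (link y p∈ σ₀ t) b
      new b with b Bool.≟ b₀
      ... | yes refl = record
        { Y′≡  = sym (trans (filter-reject (λ z → q z Bool.≟ b) y∉) (filter-all (λ z → q z Bool.≟ b) all))
        ; tree = t
        ; x∈Y′ = p∈
        ; σ    = not σ₀
        ; gain = λ s → ℕ.≤-reflexive (sym (cong₂ ℕ._+_
            (cong bit (trans
              (cong₂ (λ u v → u xor (v xor σ₀)) (extend-off s _ y∉) (extend-on s _ (All.lookup all p∈)))
              (xor-solve′ (s p) σ₀)))
            (satisfied-cong t (All.map (extend-on s _) all))))
        }
      -- All of `t` is contracted here and only `y` is left, so `y` is the anchor; the conditions
      -- inside `t` count for nothing.
      ... | no b≢ = record
        { Y′≡  = sym (trans (filter-accept (λ z → q z Bool.≟ b) y∈)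
                   (cong (y ∷_) (filter-none-b all)))
        ; tree = root y
        ; x∈Y′ = here refl
        ; σ    = not σ₀
        ; gain = λ s → ℕ.≤-trans (ℕ.≤-reflexive (sym (cong bit
            (trans (cong₂ (λ u v → u xor (v xor σ₀)) (extend-on s _ y∈)
                     (extend-off s _ λ e → b≢ (trans (sym e) (All.lookup all p∈))))
              (xor-solve (s y) σ₀)))))
            (ℕ.m≤m+n _ _)
        }
        where
        y∈ : q y ≡ b
        y∈ = trans (Bool.¬-not y∉) (sym (Bool.¬-not b≢))
        filter-none-b : ∀ {Z} → All (λ z → q z ≡ b₀) Z → side b Z ≡ []
        filter-none-b []       = refl
        filter-none-b (e ∷ es) =
          trans (filter-reject (λ z → q z Bool.≟ b) (λ e′ → b≢ (trans (sym e′) e))) (filter-none-b es)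
    contract {y ∷ Y} (link y {p} p∈ σ₀ t) | inj₂ old = inj₂ new
      where
      new : ∀ b → Contraction (link y p∈ σ₀ t) b
      new b with q y Bool.≟ b
      ... | no y∉ = record
        { Y′≡  = trans (Y′≡ (old b)) (sym (filter-reject (λ z → q z Bool.≟ b) y∉))
        ; tree = tree (old b)
        ; x∈Y′ = x∈Y′ (old b)
        ; σ    = σ (old b)
        ; gain = λ s → ℕ.≤-trans (gain (old b) s) (ℕ.m≤n+m _ _)
        }
      ... | yes y∈ with q p Bool.≟ b
      ...   | yes p∈b = record
        { Y′≡  = trans (cong (y ∷_) (Y′≡ (old b))) (sym (filter-accept (λ z → q z Bool.≟ b) y∈))
        ; tree = link y (subst (p ∈_) (sym (Y′≡ (old b))) (∈-filter⁺ (λ z → q z Bool.≟ b) p∈ p∈b)) σ₀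
                   (tree (old b))
        ; x∈Y′ = there (x∈Y′ (old b))
        ; σ    = σ (old b)
        ; gain = λ s → ℕ.≤-trans (ℕ.≤-reflexive (sym (ℕ.+-suc _ _))) (ℕ.+-mono-≤
            (ℕ.≤-reflexive (sym (cong bit
              (cong₂ (λ u v → u xor (v xor σ₀)) (extend-on s _ y∈) (extend-on s _ p∈b)))))
            (gain (old b) s))
        }
      ...   | no p∉b = record
        { Y′≡  = trans (cong (y ∷_) (Y′≡ (old b))) (sym (filter-accept (λ z → q z Bool.≟ b) y∈))
        -- The contracted parent has the colour of the anchor up to the sign `σ (old b)`, so the
        -- signs along the detour through the anchor combine.
        ; tree = link y (x∈Y′ (old b)) (σ (old b) xor σ₀) (tree (old b))
        ; x∈Y′ = there (x∈Y′ (old b))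
        ; σ    = σ (old b)
        ; gain = λ s → ℕ.≤-trans (ℕ.≤-reflexive (sym (ℕ.+-suc _ _))) (ℕ.+-mono-≤
            (ℕ.≤-reflexive (sym (cong bit (trans
              (cong₂ (λ u v → u xor (v xor σ₀)) (extend-on s _ y∈) (extend-off s _ p∉b))
              (cong (s y xor_) (Bool.xor-assoc (s (x (old b))) (σ (old b)) σ₀))))))
            (gain (old b) s))
        }

    larger-side : ∀ Y → ∃[ b ] length Y ≤ 2 ℕ.* length (side b Y)
    larger-side Y with ℕ.≤-total (length (side true Y)) (length (side false Y))
    ... | inj₁ t≤f = false , ℕ.≤-trans (ℕ.≤-reflexive (sym (length-sides false Y)))
                               (ℕ.+-monoʳ-≤ _ (ℕ.≤-trans t≤f (ℕ.m≤m+n _ 0)))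
    ... | inj₂ f≤t = true  , ℕ.≤-trans (ℕ.≤-reflexive (sym (length-sides true Y)))
                               (ℕ.+-monoʳ-≤ _ (ℕ.≤-trans f≤t (ℕ.m≤m+n _ 0)))

    -- One step from a gate into the factor on side `kept`; `rest` colours the other factor. The
    -- invariant `length Y ≤ 2 ^ satisfied` passes back up through `bound`: either no vertex is
    -- lost, or at most half of them are and one more condition is satisfied.
    record Descent {Y : List A} (t : SignedTree Y) : Set where
      field
        kept   : Bool
        {Y′}   : List A
        tree′  : SignedTree Y′
        Y′⊆Y   : Y′ ⊆ Y
        Y′!    : Unique Y → Unique Y′
        Y′-on  : ∀ {y} → y ∈ Y′ → q y ≡ kept
        rest   : (A → Bool) → Bool
        bound  : ∀ s → length Y′ ≤ 2 ^ satisfied tree′ s →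
                 length Y ≤ 2 ^ satisfied t (extend kept s (rest s))

    descend : ∀ {Y} (t : SignedTree Y) → Descent t
    descend {Y} t with contract t
    ... | inj₁ (b , all) = record
      { kept   = b
      ; tree′  = t
      ; Y′⊆Y   = λ y∈ → y∈
      ; Y′!    = λ Y! → Y!
      ; Y′-on  = All.lookup all
      -- No vertex of the tree lies off side `b`, so the colour of the other factor is arbitrary.
      ; rest   = λ _ → true
      ; bound  = λ s → subst (λ k → length Y ≤ 2 ^ k)
                   (sym (satisfied-cong t (All.map (extend-on s true) all)))
      }
    ... | inj₂ C with larger-side Y
    ...   | b , half = record
      { kept   = b
      ; tree′  = tree (C b)
      ; Y′⊆Y   = λ y∈ → proj₁ (∈-filter⁻ (λ z → q z Bool.≟ b) {xs = Y} (subst (_ ∈_) (Y′≡ (C b)) y∈))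
      ; Y′!    = λ Y! → subst Unique (sym (Y′≡ (C b))) (Unique.filter⁺ (λ z → q z Bool.≟ b) Y!)
      ; Y′-on  = λ y∈ → proj₂ (∈-filter⁻ (λ z → q z Bool.≟ b) {xs = Y} (subst (_ ∈_) (Y′≡ (C b)) y∈))
      ; rest   = colour (C b)
      ; bound  = λ s h → ℕ.≤-trans half (ℕ.≤-trans
          (ℕ.*-monoʳ-≤ 2 (subst (λ Z → length Z ≤ 2 ^ satisfied (tree (C b)) s) (Y′≡ (C b)) h))
          (ℕ.^-monoʳ-≤ 2 (gain (C b) s)))
      }

-- Two-coloured products

module _ {A : Set} where

  All-interleaving⁻ : ∀ {P : A → Set} {X Y Z} → Interleaving X Y Z → All P Z → All P X × All P Y
  All-interleaving⁻ []          []       = [] , []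
  All-interleaving⁻ (refl ∷ˡ s) (p ∷ ps) with l , r ← All-interleaving⁻ s ps = p ∷ l , r
  All-interleaving⁻ (refl ∷ʳ s) (p ∷ ps) with l , r ← All-interleaving⁻ s ps = l , p ∷ r

  Unique-interleaving⁻ : ∀ {X Y Z : List A} → Interleaving X Y Z → Unique Z →
                         Unique X × Unique Y × (∀ {i} → i ∈ X → i ∉ Y)
  Unique-interleaving⁻ [] [] = [] , [] , λ ()
  Unique-interleaving⁻ (refl ∷ˡ s) (z∉ ∷ Z!)
    with X! , Y! , X∩Y ← Unique-interleaving⁻ s Z! | z∉X , z∉Y ← All-interleaving⁻ s z∉ =
    z∉X ∷ X! , Y! , λ { (here refl) i∈Y → All.lookup z∉Y i∈Y refl ; (there i∈X) → X∩Y i∈X }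
  Unique-interleaving⁻ (refl ∷ʳ s) (z∉ ∷ Z!)
    with X! , Y! , X∩Y ← Unique-interleaving⁻ s Z! | z∉X , z∉Y ← All-interleaving⁻ s z∉ =
    X! , z∉Y ∷ Y! , λ { i∈X (here refl) → All.lookup z∉X i∈X refl ; i∈X (there i∈Y) → X∩Y i∈X i∈Y }

  ∈-interleaving⁻ : ∀ {X Y Z : List A} → Interleaving X Y Z → ∀ {i} → i ∈ Z → i ∈ X ⊎ i ∈ Y
  ∈-interleaving⁻ (refl ∷ˡ s) (here refl) = inj₁ (here refl)
  ∈-interleaving⁻ (refl ∷ˡ s) (there i∈)  = Sum.map₁ there (∈-interleaving⁻ s i∈)
  ∈-interleaving⁻ (refl ∷ʳ s) (here refl) = inj₂ (here refl)
  ∈-interleaving⁻ (refl ∷ʳ s) (there i∈)  = Sum.map₂ there (∈-interleaving⁻ s i∈)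

  Agree : ∀ {N} → (A → Bool) → Bool → ∀ {X} → Assignment N X → Assignment N X → Set
  Agree κ b []                []         = ⊤
  Agree κ b {i ∷ _} (a ∷ x) (a′ ∷ x′) = (κ i ≡ b → a ≡ a′) × Agree κ b x x′

  Agree-refl : ∀ {N} (κ : A → Bool) b {X} (x : Assignment N X) → Agree κ b x x
  Agree-refl κ b []      = tt
  Agree-refl κ b (a ∷ x) = const refl , Agree-refl κ b x

  Agree⇒≡ : ∀ {N} {κ : A → Bool} {b X} → All (λ i → κ i ≡ b) X → (x x′ : Assignment N X) →
            Agree κ b x x′ → x ≡ x′
  Agree⇒≡ []       []      []        _        = refl
  Agree⇒≡ (e ∷ es) (a ∷ x) (a′ ∷ x′) (h , hs) = cong₂ _∷_ (h e) (Agree⇒≡ es x x′ hs)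

  Agree-restrictˡ : ∀ {N} {κ κ′ : A → Bool} {b X Y Z} (s : Interleaving X Y Z) →
                    All (λ i → κ i ≡ b → κ′ i ≡ b) X → {z z′ : Assignment N Z} →
                    Agree κ′ b z z′ → Agree κ b (restrictˡ s z) (restrictˡ s z′)
  Agree-restrictˡ []          []       {[]}    {[]}      _        = tt
  Agree-restrictˡ (refl ∷ˡ s) (e ∷ es) {_ ∷ _} {_ ∷ _}   (h , hs) = h ∘ e , Agree-restrictˡ s es hs
  Agree-restrictˡ (refl ∷ʳ s) es       {_ ∷ _} {_ ∷ _}   (h , hs) = Agree-restrictˡ s es hs

  Agree-restrictʳ : ∀ {N} {κ κ′ : A → Bool} {b X Y Z} (s : Interleaving X Y Z) →
                    All (λ i → κ i ≡ b → κ′ i ≡ b) Y → {z z′ : Assignment N Z} →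
                    Agree κ′ b z z′ → Agree κ b (restrictʳ s z) (restrictʳ s z′)
  Agree-restrictʳ []          []       {[]}    {[]}      _        = tt
  Agree-restrictʳ (refl ∷ˡ s) es       {_ ∷ _} {_ ∷ _}   (h , hs) = Agree-restrictʳ s es hs
  Agree-restrictʳ (refl ∷ʳ s) (e ∷ es) {_ ∷ _} {_ ∷ _}   (h , hs) = h ∘ e , Agree-restrictʳ s es hs

Unique-⊆-[i] : ∀ {A : Set} {i : A} {Y} → Unique Y → Y ⊆ (i ∷ []) → length Y ≤ 1
Unique-⊆-[i] {Y = []}        _                _   = z≤n
Unique-⊆-[i] {Y = _ ∷ []}    _                _   = s≤s z≤n
Unique-⊆-[i] {Y = _ ∷ _ ∷ _} ((x≢y ∷ _) ∷ _) sub with sub (here refl) | sub (there (here refl))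
... | here refl | here refl = ⊥-elim (x≢y refl)

module Branching {c ℓ₁ ℓ₂ : Level} (F : HeytingField c ℓ₁ ℓ₂) where
  open HeytingField F using (_≈_; _*_; 0#; 1#; heytingCommutativeRing)
  open CommutativeRing (HeytingCommutativeRing.commutativeRing heytingCommutativeRing)
    using (_+_; +-rawMonoid; +-cong; +-congˡ; *-cong; *-congˡ; *-congʳ; *-comm; *-assoc;
           +-assoc; +-comm; zeroˡ; distribʳ; +-identityˡ; *-identityʳ; reflexive)
    renaming (refl to ≈-refl; sym to ≈-sym; trans to ≈-trans)
  open RawMonoidDefs +-rawMonoid using (sum)
  open RawMonoidDefs ℕ.+-0-rawMonoid using () renaming (sum to sumℕ)

  DependsOn : ∀ {A : Set} {N} → (A → Bool) → Bool → ∀ {X : List A} → Tensor F N X → Set ℓ₁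
  DependsOn κ b f = ∀ x x′ → Agree κ b x x′ → f x ≈ f x′

  -- Both factors live on the full index list and `depends` says what they read. Further factors can
  -- thus be multiplied in without splitting the index list by colour.
  record ColouredProduct {A : Set} (N : ℕ) (X : List A) : Set (c ⊔ ℓ₁) where
    field
      colouring : A → Bool
      factor    : Bool → Tensor F N X
      depends   : ∀ b → DependsOn colouring b (factor b)

    product : Tensor F N X
    product x = factor true x * factor false x

  open ColouredProduct

  Σproduct : ∀ {A : Set} {N} {X : List A} → List (ColouredProduct N X) → Tensor F N X
  Σproduct []       x = 0#
  Σproduct (π ∷ πs) x = product π x + Σproduct πs x

  Σproduct-++ : ∀ {A : Set} {N} {X : List A} (πs ρs : List (ColouredProduct N X)) x →
                Σproduct (πs ++ ρs) x ≈ Σproduct πs x + Σproduct ρs x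
  Σproduct-++ []       ρs x = ≈-sym (+-identityˡ _)
  Σproduct-++ (π ∷ πs) ρs x = ≈-trans (+-congˡ (Σproduct-++ πs ρs x)) (≈-sym (+-assoc _ _ _))

  -- The tree is common to all terms, but each term has its own colouring, which satisfies at least
  -- log₂ of the number of vertices.
  record Decomposition {N : ℕ} {X : List Edge} {Y : List Edge}
                       (B : Tensor F N X) (L : ℕ) (t : SignedTree Y) : Set (c ⊔ ℓ₁) where
    field
      terms    : List (ColouredProduct N X)
      length≤  : length terms ≤ L
      sums     : ∀ x → B x ≈ Σproduct terms x
      tree≤    : All (λ π → length Y ≤ 2 ^ satisfied t (colouring π)) terms

  open Decomposition

  decomposition-sum : ∀ {N X Y} {t : SignedTree Y} k (B : Fin k → Tensor F N X) (L : Fin k → ℕ) →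
    (∀ i → Decomposition (B i) (L i) t) → Decomposition (λ x → sum (λ i → B i x)) (sumℕ L) t
  decomposition-sum zero B L d = record
    { terms = [] ; length≤ = z≤n ; sums = λ _ → ≈-refl ; tree≤ = [] }
  decomposition-sum (suc k) B L d = record
    { terms   = terms d₀ ++ terms ds
    ; length≤ = ℕ.≤-trans (ℕ.≤-reflexive (length-++ (terms d₀))) (ℕ.+-mono-≤ (length≤ d₀) (length≤ ds))
    ; sums    = λ x → ≈-trans (+-cong (sums d₀ x) (sums ds x)) (≈-sym (Σproduct-++ (terms d₀) (terms ds) x))
    ; tree≤   = All.++⁺ (tree≤ d₀) (tree≤ ds)
    }
    where
    d₀ = d Fin.zero
    ds = decomposition-sum k (B ∘ Fin.suc) (L ∘ Fin.suc) (d ∘ Fin.suc)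

  decomposition-mono : ∀ {N X Y} {t : SignedTree Y} {B B′ : Tensor F N X} {L L′} →
    (∀ x → B′ x ≈ B x) → L ≤ L′ → Decomposition B L t → Decomposition B′ L′ t
  decomposition-mono eq le d = record
    { terms   = terms d
    ; length≤ = ℕ.≤-trans (length≤ d) le
    ; sums    = λ x → ≈-trans (eq x) (sums d x)
    ; tree≤   = tree≤ d
    }

  -- What `restrictˡ` and `restrictʳ` have in common, so that one argument covers the descent into
  -- either factor of a gate.
  record Restriction (N : ℕ) (Z X : List Edge) : Set where
    field
      restrict : Assignment N Z → Assignment N X
      agree    : ∀ {κ κ′ b} → All (λ i → κ i ≡ b → κ′ i ≡ b) X → ∀ {z z′} →
                 Agree κ′ b z z′ → Agree κ b (restrict z) (restrict z′)
  open Restriction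

  module _ {N : ℕ} {X X′ Z : List Edge} (r : Restriction N Z X) (r′ : Restriction N Z X′)
           (q : Edge → Bool) {b : Bool}
           (on : ∀ {i} → i ∈ X → q i ≡ b) (off : ∀ {i} → i ∈ X′ → q i ≢ b)
           (C : Tensor F N X′) (rest : (Edge → Bool) → Bool) where

    -- The first `Bool` is the colour given to the kept factor `C`, the second selects a factor of
    -- the product; `C` is absorbed by the factor of its own colour.
    extendFactor : ColouredProduct N X → Bool → Bool → Tensor F N Z
    extendFactor π true  true  z = factor π true (restrict r z) * C (restrict r′ z)
    extendFactor π true  false z = factor π false (restrict r z)
    extendFactor π false true  z = factor π true (restrict r z)
    extendFactor π false false z = factor π false (restrict r z) * C (restrict r′ z)

    extendProduct : ColouredProduct N X → ColouredProduct N Z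
    extendProduct π = record
      { colouring = κ
      ; factor    = extendFactor π c₀
      ; depends   = dep c₀ (λ i∈ → extend-off q (colouring π) c₀ (off i∈))
      }
      where
      c₀ = rest (colouring π)
      κ : Edge → Bool
      κ = extend q b (colouring π) c₀
      depX : ∀ b′ → DependsOn κ b′ (λ z → factor π b′ (restrict r z))
      depX b′ z z′ h = depends π b′ _ _
        (agree r (All.tabulate λ i∈ e → trans (extend-on q (colouring π) c₀ (on i∈)) e) h)
      depC : ∀ b′ → (∀ {i} → i ∈ X′ → κ i ≡ b′) → DependsOn κ b′ (λ z → C (restrict r′ z))
      depC b′ eq z z′ h = reflexive (cong C (Agree⇒≡ {κ = const b′} (All.tabulate λ _ → refl) _ _
        (agree r′ (All.tabulate λ i∈ _ → eq i∈) h)))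
      dep : ∀ d → (∀ {i} → i ∈ X′ → κ i ≡ d) → ∀ b′ → DependsOn κ b′ (extendFactor π d b′)
      dep true  eq true  z z′ h = *-cong (depX true z z′ h) (depC true eq z z′ h)
      dep true  eq false z z′ h = depX false z z′ h
      dep false eq true  z z′ h = depX true z z′ h
      dep false eq false z z′ h = *-cong (depX false z z′ h) (depC false eq z z′ h)

    product-extend : ∀ π z → product (extendProduct π) z ≈ product π (restrict r z) * C (restrict r′ z)
    product-extend π z with rest (colouring π)
    ... | true  = ≈-trans (*-assoc _ _ _) (≈-trans (*-congˡ (*-comm _ _)) (≈-sym (*-assoc _ _ _)))
    ... | false = ≈-sym (*-assoc _ _ _)

    Σproduct-extend : ∀ πs z → Σproduct (map extendProduct πs) z ≈ Σproduct πs (restrict r z) * C (restrict r′ z)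
    Σproduct-extend []       z = ≈-sym (zeroˡ _)
    Σproduct-extend (π ∷ πs) z = ≈-trans (+-cong (product-extend π z) (Σproduct-extend πs z)) (≈-sym (distribʳ _ _ _))

    decomposition-extend : ∀ {Y Y′ L} {B : Tensor F N X} {t : SignedTree Y} {t′ : SignedTree Y′} →
      (∀ s → length Y′ ≤ 2 ^ satisfied t′ s → length Y ≤ 2 ^ satisfied t (extend q b s (rest s))) →
      Decomposition B L t′ → Decomposition (λ z → B (restrict r z) * C (restrict r′ z)) L t
    decomposition-extend bound d = record
      { terms   = map extendProduct (terms d)
      ; length≤ = ℕ.≤-trans (ℕ.≤-reflexive (length-map extendProduct (terms d))) (length≤ d)
      ; sums    = λ z → ≈-trans (*-congʳ (sums d (restrict r z))) (≈-sym (Σproduct-extend (terms d) z))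
      ; tree≤   = All.map⁺ (All.map (bound _) (tree≤ d))
      }

  -- Induction on the formula. At a gate, `descend` chooses the factor to be decomposed further, and
  -- the other one is multiplied into every resulting term. The number of terms is therefore bounded
  -- by the cost of the chosen factor alone.
  decompose : ∀ {N} k {X} (B : Tensor F N X) {L} → IsLsm≤ F k B L → Unique X →
              ∀ {Y} (t : SignedTree Y) → Unique Y → Y ⊆ X → Decomposition B L t
  decompose (suc k) {i ∷ []} B (lift (inj₁ (_ , refl))) X! t Y! Y⊆X = record
    { terms   = record
        { colouring = const true
        ; factor    = λ { true → B ; false → const 1# }
        ; depends   = λ { true x x′ h → reflexive (cong B (Agree⇒≡ (refl ∷ []) x x′ h)) ; false _ _ _ → ≈-refl }
        } ∷ []
    ; length≤ = ℕ.≤-refl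
    ; sums    = λ x → ≈-sym (≈-trans (≈-trans (+-comm _ _) (+-identityˡ _)) (*-identityʳ _))
    -- At a leaf at most one vertex is left, so even an unsatisfied tree meets the bound.
    ; tree≤   = ℕ.≤-trans (Unique-⊆-[i] Y! Y⊆X) (ℕ.m^n>0 2 (satisfied t (const true))) ∷ []
    }
  decompose (suc k) {i ∷ []} B (lift (inj₂ (B≈0 , refl))) X! t Y! Y⊆X = record
    { terms = [] ; length≤ = z≤n ; sums = B≈0 ; tree≤ = [] }
  decompose (suc k) {X = Z@(_ ∷ _ ∷ _)} B ((m , τ , l , r , B≈ , IsL , refl) , _) Z! t T! T⊆Z =
    decomposition-mono B≈ ℕ.≤-refl (decomposition-sum m (λ i → Term.value (τ i)) (λ i → l i ℕ.+ r i) term)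
    where
    term : ∀ i → Decomposition (Term.value (τ i)) (l i ℕ.+ r i) t
    term i with X! , Y! , X∩Y ← Unique-interleaving⁻ (Term.split (τ i)) Z! = go (descend q t)
      where
      open Term (τ i)
      q : Edge → Bool
      q e = does (e ∈? X)
      q-X : ∀ {e} → e ∈ X → q e ≡ true
      q-X {e} e∈ = dec-true (e ∈? X) e∈
      q-Y : ∀ {e} → e ∈ Y → q e ≡ false
      q-Y {e} e∈ = dec-false (e ∈? X) λ e∈X → X∩Y e∈X e∈
      q⁻ : ∀ {e b} → e ∈ Z → q e ≡ b → (if b then e ∈ X else e ∈ Y)
      q⁻ e∈ qe with ∈-interleaving⁻ split e∈
      q⁻ {b = true}  e∈ qe | inj₁ e∈X = e∈X
      q⁻ {b = false} e∈ qe | inj₁ e∈X = contradiction (trans (sym (q-X e∈X)) qe) λ ()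
      q⁻ {b = true}  e∈ qe | inj₂ e∈Y = contradiction (trans (sym (q-Y e∈Y)) qe) λ ()
      q⁻ {b = false} e∈ qe | inj₂ e∈Y = e∈Y

      rˡ : Restriction _ Z X
      rˡ = record { restrict = restrictˡ split ; agree = Agree-restrictˡ split }
      rʳ : Restriction _ Z Y
      rʳ = record { restrict = restrictʳ split ; agree = Agree-restrictʳ split }

      go : Descent q t → Decomposition value (l i ℕ.+ r i) t
      go record { kept = true ; tree′ = t′ ; Y′⊆Y = Y′⊆ ; Y′! = Y′! ; Y′-on = on ; rest = rest ; bound = bound } =
        decomposition-mono (λ _ → ≈-refl) (ℕ.m≤m+n _ _)
          (decomposition-extend rˡ rʳ q q-X
            (λ e∈ eq → contradiction (trans (sym (q-Y e∈)) eq) λ ()) right rest bound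
            (decompose k left (proj₁ (IsL i)) X! t′ (Y′! T!) (λ e∈ → q⁻ (T⊆Z (Y′⊆ e∈)) (on e∈))))
      go record { kept = false ; tree′ = t′ ; Y′⊆Y = Y′⊆ ; Y′! = Y′! ; Y′-on = on ; rest = rest ; bound = bound } =
        decomposition-mono (λ _ → *-comm _ _) (ℕ.m≤n+m _ _)
          (decomposition-extend rʳ rˡ q q-Y
            (λ e∈ eq → contradiction (trans (sym (q-X e∈)) eq) λ ()) left rest bound
            (decompose k right (proj₂ (IsL i)) Y! t′ (Y′! T!) (λ e∈ → q⁻ (T⊆Z (Y′⊆ e∈)) (on e∈))))

-- Ranks and factorisations

module Ranks {c ℓ₁ ℓ₂ : Level} (F : HeytingField c ℓ₁ ℓ₂) where
  open HeytingField F using (Carrier; _≈_; _#_; _*_; 0#; 1#; heytingCommutativeRing; tight; #⇒invertible)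
  R : CommutativeRing c ℓ₁
  R = HeytingCommutativeRing.commutativeRing heytingCommutativeRing
  open CommutativeRing R
    using (_+_; -_; ring; semiring; setoid; +-cong; +-congˡ; +-congʳ; *-congˡ; *-congʳ; *-comm; *-assoc;
           +-assoc; +-comm; zeroʳ; distribˡ; +-identityˡ; +-identityʳ; *-identityʳ; reflexive; -‿cong; -‿inverseˡ)
    renaming (refl to ≈-refl; sym to ≈-sym; trans to ≈-trans)
  open RingProperties ring using (-‿distribˡ-*)
  open HeytingProperties heytingCommutativeRing using (1#0; x-0≈x)
  open SemiringSum semiring using (sum; sum-cong-≋; sum-remove; ∑-distrib-+; *-distribˡ-sum)
  open import Relation.Binary.Reasoning.Setoid setoid

  sum-zero : ∀ {n} {f : Fin n → Carrier} → (∀ i → f i ≈ 0#) → sum f ≈ 0#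
  sum-zero {zero}  h = ≈-refl
  sum-zero {suc n} h = ≈-trans (+-cong (h Fin.zero) (sum-zero (h ∘ Fin.suc))) (+-identityˡ _)

  infix 7 _·_
  _·_ : ∀ {n} → (Fin n → Carrier) → (Fin n → Carrier) → Carrier
  a · v = sum λ j → a j * v j

  ·-eliminate : ∀ {n} (a v w : Fin n → Carrier) x →
                a · (λ j → v j + - (x * w j)) ≈ a · v + - x * (a · w)
  ·-eliminate a v w x = begin
    a · (λ j → v j + - (x * w j))           ≈⟨ sum-cong-≋ (λ j → ≈-trans (distribˡ _ _ _) (+-congˡ (step (a j) (w j)))) ⟩
    sum (λ j → a j * v j + - x * (a j * w j)) ≈⟨ ∑-distrib-+ (λ j → a j * v j) _ ⟩
    a · v + sum (λ j → - x * (a j * w j))   ≈⟨ +-congˡ (*-distribˡ-sum (- x) (λ j → a j * w j)) ⟨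
    a · v + - x * (a · w)                   ∎
    where
    step : ∀ p q → p * - (x * q) ≈ - x * (p * q)
    step p q = begin
      p * - (x * q)  ≈⟨ *-congˡ (-‿distribˡ-* x q) ⟩
      p * (- x * q)  ≈⟨ *-assoc _ _ _ ⟨
      p * - x * q    ≈⟨ *-congʳ (*-comm _ _) ⟩
      - x * p * q    ≈⟨ *-assoc _ _ _ ⟩
      - x * (p * q)  ∎

  ·-insertAt : ∀ {n} (a : Fin n → Carrier) j x (v : Fin (suc n) → Carrier) →
               insertAt a j x · v ≈ x * v j + a · (v ∘ punchIn j)
  ·-insertAt a j x v = ≈-trans (sum-remove {i = j} (λ k → insertAt a j x k * v k))
    (+-cong (*-congʳ (reflexive (insertAt-lookup a j x)))
            (sum-cong-≋ λ k → *-congʳ (reflexive (insertAt-punchIn a j x k))))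

  Annihilator : ∀ {r} → List (Fin r → Carrier) → Set (c ⊔ ℓ₁)
  Annihilator {r} vs = Σ (Fin r → Carrier) λ a → All (λ v → a · v ≈ 0#) vs × ∃[ j ] ¬ (a j ≈ 0#)

  -- Gaussian elimination for fewer equations than unknowns. Whether some entry of `w` is apart from
  -- `0#` need not be decidable, hence the double negation; if none is, `w` vanishes by tightness.
  ¬¬annihilator : ∀ m {r} (vs : List (Fin r → Carrier)) → length vs ≤ m → m < r → ¬ ¬ Annihilator vs
  ¬¬annihilator _ {suc r} [] _ _ k = k (const 1# , [] , Fin.zero , λ 1≈0 → proj₂ (tight 1# 0#) 1≈0 1#0)
  ¬¬annihilator (suc m) {suc r} (w ∷ vs) (s≤s vs≤m) (s≤s m<r) k = ¬¬-excluded-middle {A = ∃[ j ] w j # 0#} λ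
    { (yes (j , wj#0)) → pivot j (#⇒invertible wj#0)
    ; (no w≈0) → ¬¬annihilator m vs vs≤m (ℕ.m≤n⇒m≤1+n m<r) λ (a , a·vs , nz) →
        k (a , sum-zero {f = λ i → a i * w i} (λ i →
          ≈-trans (*-congˡ (proj₁ (tight (w i) 0#) (λ wi#0 → w≈0 (i , wi#0)))) (zeroʳ (a i))) ∷ a·vs , nz)
    }
    where
    pivot : ∀ j → Σ Carrier (λ y → _ × _) → ⊥
    pivot j (y , y*w≈1 , _) = ¬¬annihilator m
      (map reduce vs) (ℕ.≤-trans (ℕ.≤-reflexive (length-map reduce vs)) vs≤m) m<r
      λ (a , a·vs , j′ , aj′≉0) → k
        ( insertAt a j (x a)
        , ≈-trans (·-insertAt a j (x a) w) (w-zero a) ∷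
          All.map (λ {v} h → ≈-trans (·-insertAt a j (x a) v) (v-zero a v h)) (All.map⁻ a·vs)
        , punchIn j j′ , λ e → aj′≉0 (≈-trans (reflexive (sym (insertAt-punchIn a j (x a) j′))) e))
      where
      w′ : Fin r → Carrier
      w′ = w ∘ punchIn j
      reduce : (Fin (suc r) → Carrier) → Fin r → Carrier
      reduce v i = v (punchIn j i) + - (v j * y * w′ i)
      -- The value of the unknown `j` for which `w` vanishes, given values `a` of the other
      -- unknowns; `y` inverts the pivot `w j`.
      x : (Fin r → Carrier) → Carrier
      x a = - (y * (a · w′))

      v-zero : ∀ a v → a · reduce v ≈ 0# → x a * v j + a · (v ∘ punchIn j) ≈ 0#
      v-zero a v h = begin
        x a * v j + a · v′            ≈⟨ +-comm _ _ ⟩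
        a · v′ + x a * v j            ≈⟨ +-congˡ step ⟩
        a · v′ + - (v j * y) * (a · w′) ≈⟨ ·-eliminate a v′ w′ (v j * y) ⟨
        a · reduce v                  ≈⟨ h ⟩
        0#                            ∎
        where
        v′ = v ∘ punchIn j
        step : x a * v j ≈ - (v j * y) * (a · w′)
        step = begin
          - (y * (a · w′)) * v j   ≈⟨ -‿distribˡ-* _ _ ⟨
          - (y * (a · w′) * v j)   ≈⟨ -‿cong (≈-trans (*-comm _ _) (≈-sym (*-assoc _ _ _))) ⟩
          - (v j * y * (a · w′))   ≈⟨ -‿distribˡ-* _ _ ⟩
          - (v j * y) * (a · w′)   ∎

      w-zero : ∀ a → x a * w j + a · w′ ≈ 0#
      w-zero a = begin
        x a * w j + a · w′           ≈⟨ +-congʳ (-‿distribˡ-* _ _) ⟨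
        - (y * (a · w′) * w j) + a · w′ ≈⟨ +-congʳ (-‿cong step) ⟩
        - (a · w′) + a · w′          ≈⟨ -‿inverseˡ _ ⟩
        0#                           ∎
        where
        step : y * (a · w′) * w j ≈ a · w′
        step = begin
          y * (a · w′) * w j    ≈⟨ *-congʳ (*-comm _ _) ⟩
          (a · w′) * y * w j    ≈⟨ *-assoc _ _ _ ⟩
          -- What `#⇒invertible` inverts is the difference of `w j` and `0#`, which is first
          -- identified with `w j`.
          (a · w′) * (y * w j)  ≈⟨ *-congˡ (≈-trans (*-congˡ (≈-sym (x-0≈x _))) y*w≈1) ⟩
          (a · w′) * 1#         ≈⟨ *-identityʳ _ ⟩
          a · w′                ∎

  module _ {I J : Set} where

    Σouter : List ((I → Carrier) × (J → Carrier)) → I → J → Carrier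
    Σouter []             i j = 0#
    Σouter ((u , v) ∷ ps) i j = u i * v j + Σouter ps i j

    Σouter-++ : ∀ ps qs i j → Σouter (ps ++ qs) i j ≈ Σouter ps i j + Σouter qs i j
    Σouter-++ []             qs i j = ≈-sym (+-identityˡ _)
    Σouter-++ ((u , v) ∷ ps) qs i j = ≈-trans (+-congˡ (Σouter-++ ps qs i j)) (≈-sym (+-assoc _ _ _))

    -- A rank bound carried by explicit outer products. Such bounds can be added and scaled without
    -- knowing that the ranks exist.
    record Factorisation (M : I → J → Carrier) (m : ℕ) : Set (c ⊔ ℓ₁) where
      field
        pairs   : List ((I → Carrier) × (J → Carrier))
        length≤ : length pairs ≤ m
        sums    : ∀ i j → M i j ≈ Σouter pairs i j
    open Factorisation

    factorisation-cong : ∀ {M M′ m} → (∀ i j → M′ i j ≈ M i j) → Factorisation M m → Factorisation M′ m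
    factorisation-cong eq φ = record
      { pairs = pairs φ ; length≤ = length≤ φ ; sums = λ i j → ≈-trans (eq i j) (sums φ i j) }

    factorisation-zero : Factorisation (λ _ _ → 0#) 0
    factorisation-zero = record { pairs = [] ; length≤ = z≤n ; sums = λ _ _ → ≈-refl }

    factorisation-outer : ∀ u v → Factorisation (λ i j → u i * v j) 1
    factorisation-outer u v = record
      { pairs = (u , v) ∷ [] ; length≤ = ℕ.≤-refl ; sums = λ _ _ → ≈-sym (+-identityʳ _) }

    factorisation-+ : ∀ {M M′ m m′} → Factorisation M m → Factorisation M′ m′ →
                      Factorisation (λ i j → M i j + M′ i j) (m ℕ.+ m′)
    factorisation-+ φ ψ = record
      { pairs   = pairs φ ++ pairs ψ
      ; length≤ = ℕ.≤-trans (ℕ.≤-reflexive (length-++ (pairs φ))) (ℕ.+-mono-≤ (length≤ φ) (length≤ ψ))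
      ; sums    = λ i j → ≈-trans (+-cong (sums φ i j) (sums ψ i j)) (≈-sym (Σouter-++ (pairs φ) (pairs ψ) i j))
      }

    factorisation-sum : ∀ n {M : Fin n → I → J → Carrier} {m} → (∀ k → Factorisation (M k) m) →
                        Factorisation (λ i j → sum λ k → M k i j) (n ℕ.* m)
    factorisation-sum zero    φ = factorisation-zero
    factorisation-sum (suc n) φ = factorisation-+ (φ Fin.zero) (factorisation-sum n (φ ∘ Fin.suc))

    factorisation-scale : ∀ {M m} (h : I → Carrier) (h′ : J → Carrier) → Factorisation M m →
                          Factorisation (λ i j → h i * h′ j * M i j) m
    factorisation-scale {M} {m} h h′ φ = record
      { pairs   = map scale (pairs φ)
      ; length≤ = ℕ.≤-trans (ℕ.≤-reflexive (length-map scale (pairs φ))) (length≤ φ)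
      ; sums    = λ i j → ≈-trans (*-congˡ (sums φ i j)) (go (pairs φ) i j)
      }
      where
      scale : (I → Carrier) × (J → Carrier) → (I → Carrier) × (J → Carrier)
      scale (u , v) = (λ i → h i * u i) , (λ j → h′ j * v j)
      shuffle : ∀ a b u v → a * b * (u * v) ≈ a * u * (b * v)
      shuffle a b u v = begin
        a * b * (u * v)    ≈⟨ *-assoc _ _ _ ⟩
        a * (b * (u * v))  ≈⟨ *-congˡ (*-assoc _ _ _) ⟨
        a * (b * u * v)    ≈⟨ *-congˡ (*-congʳ (*-comm _ _)) ⟩
        a * (u * b * v)    ≈⟨ *-congˡ (*-assoc _ _ _) ⟩
        a * (u * (b * v))  ≈⟨ *-assoc _ _ _ ⟨
        a * u * (b * v)    ∎
      go : ∀ ps i j → h i * h′ j * Σouter ps i j ≈ Σouter (map scale ps) i j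
      go []             i j = zeroʳ _
      go ((u , v) ∷ ps) i j = ≈-trans (distribˡ _ _ _) (+-cong (shuffle _ _ _ _) (go ps i j))

    -- A vector annihilating all `v ∘ cols` is a linear relation between the chosen columns of `M`.
    -- With more columns than pairs a nonzero one cannot fail to exist, and independence refutes it.
    independent≤ : ∀ {M m} → Factorisation M m → ∀ {r} (cols : Fin r → J) →
                   IsIndependent F (λ j i → M i (cols j)) → r ≤ m
    independent≤ {M} φ {r} cols ind with r ℕ.≤? length (pairs φ)
    ... | yes r≤ = ℕ.≤-trans r≤ (length≤ φ)
    ... | no r≰  = ⊥-elim (¬¬annihilator _ (map column (pairs φ))
      (ℕ.≤-reflexive (length-map column (pairs φ))) (ℕ.≰⇒> r≰)
      λ (a , a·vs , j , aj≉0) → aj≉0 (ind a (λ i →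
        ≈-trans (sum-cong-≋ (λ j → *-congˡ (sums φ i (cols j)))) (vanish a i (pairs φ) (All.map⁻ a·vs))) j))
      where
      column : (I → Carrier) × (J → Carrier) → Fin r → Carrier
      column (u , v) = v ∘ cols
      vanish : ∀ a i ps → All (λ p → a · column p ≈ 0#) ps → a · (λ j → Σouter ps i (cols j)) ≈ 0#
      vanish a i []             []       = sum-zero {f = λ j → a j * 0#} λ j → zeroʳ (a j)
      vanish a i ((u , v) ∷ ps) (h ∷ hs) = begin
        a · (λ j → u i * v (cols j) + Σouter ps i (cols j))
          ≈⟨ sum-cong-≋ (λ j → ≈-trans (distribˡ _ _ _) (+-congʳ (swap (a j) (u i) (v (cols j))))) ⟩
        sum (λ j → u i * (a j * v (cols j)) + a j * Σouter ps i (cols j))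
          ≈⟨ ∑-distrib-+ (λ j → u i * (a j * v (cols j))) _ ⟩
        sum (λ j → u i * (a j * v (cols j))) + a · (λ j → Σouter ps i (cols j))
          ≈⟨ +-cong (≈-trans (≈-sym (*-distribˡ-sum (u i) (λ j → a j * v (cols j))))
                             (≈-trans (*-congˡ h) (zeroʳ _))) (vanish a i ps hs) ⟩
        0# + 0#  ≈⟨ +-identityˡ _ ⟩
        0#       ∎
        where
        swap : ∀ p q s → p * (q * s) ≈ q * (p * s)
        swap p q s = ≈-trans (≈-sym (*-assoc _ _ _)) (≈-trans (*-congʳ (*-comm _ _)) (*-assoc _ _ _))

    rank≤size : ∀ {M m r} → Factorisation M m → IsRank F M r → r ≤ m
    rank≤size φ ((cols , ind) , _) = independent≤ φ cols ind

    -- The search goes down from the size of the factorisation and stops at the first size with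
    -- independent columns; only the test at each size needs excluded middle.
    ¬¬rank : ∀ {M m} → Factorisation M m → ¬ ¬ (∃[ r ] IsRank F M r)
    ¬¬rank {M} {m} φ = search m (λ r (cols , ind) → independent≤ φ cols ind)
      where
      P : ℕ → Set _
      P r = Σ (Fin r → J) λ cols → IsIndependent F (λ j i → M i (cols j))
      search : ∀ b → (∀ r → P r → r ≤ b) → ¬ ¬ (∃[ r ] IsRank F M r)
      search zero    h k = k (0 , ((λ ()) , λ _ _ ()) , h)
      search (suc b) h k = ¬¬-excluded-middle λ
        { (yes p) → k (suc b , p , h)
        ; (no ¬p) → search b (λ r p → ℕ.≤-pred (ℕ.≤∧≢⇒< (h r p) λ { refl → ¬p p })) k }

-- Flattenings of two-coloured products

-- With `inj₁` for rows and `inj₂` for columns, the charged coordinates are the rows coloured `true`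
-- and the columns coloured `false`. They are the ones `factorise` sums over, each costing a factor
-- `n`.
charge : ∀ {P Q : Set} → P ⊎ Q → Bool → Bool
charge (inj₁ _) k = k
charge (inj₂ _) k = not k

module _ {A : Set} {X Y : List A} where

  cost : (A → Bool) → (D : List A) → (∀ {d} → d ∈ D → d ∈ X ⊎ d ∈ Y) → ℕ
  cost κ []      cov = 0
  cost κ (d ∷ D) cov = bit (charge (cov (here refl)) (κ d)) ℕ.+ cost κ D (cov ∘ there)

  assemble : ∀ {n} (D : List A) → (∀ {d} → d ∈ D → d ∈ X ⊎ d ∈ Y) →
             Assignment n X → Assignment n Y → Assignment n D
  assemble D cov x y = All.tabulate (λ d∈D → [ All.lookup x , All.lookup y ]′ (cov d∈D))

module Flattening {c ℓ₁ ℓ₂ : Level} (F : HeytingField c ℓ₁ ℓ₂) where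
  open HeytingField F using (Carrier; _≈_; _*_; 0#; 1#)
  open Branching F using (DependsOn)
  open Ranks F
  open CommutativeRing R
    using (_+_; semiring; +-cong; *-congˡ; *-congʳ; *-comm; zeroˡ; *-identityˡ; *-identityʳ; +-identityʳ)
    renaming (refl to ≈-refl; sym to ≈-sym; trans to ≈-trans)
  open SemiringSum semiring using (sum; sum-remove)

  δ : ∀ {n} → Fin n → Fin n → Carrier
  δ a k = if does (a Fin.≟ k) then 1# else 0#

  δ-refl : ∀ {n} (a : Fin n) → δ a a ≈ 1#
  δ-refl a rewrite dec-true (a Fin.≟ a) refl = ≈-refl

  δ-≢ : ∀ {n} {a k : Fin n} → a ≢ k → δ a k ≈ 0#
  δ-≢ {a = a} {k} a≢k rewrite dec-false (a Fin.≟ k) a≢k = ≈-refl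

  sum-pick : ∀ {n} (w h : Fin n → Carrier) a → w a ≈ 1# → (∀ {k} → a ≢ k → w k ≈ 0#) →
             h a ≈ sum (λ k → w k * h k)
  sum-pick {suc n} w h a w≈1 w≈0 = ≈-sym (≈-trans (sum-remove {i = a} (λ k → w k * h k))
    (≈-trans (+-cong (≈-trans (*-congʳ w≈1) (*-identityˡ _))
                     (sum-zero (λ k → ≈-trans (*-congʳ (w≈0 (Fin.punchInᵢ≢i a k ∘ sym))) (zeroˡ (h (punchIn a k))))))
             (+-identityʳ _)))

  module _ {A : Set} {X Y : List A} {n : ℕ} (a₀ : Fin n) (κ : A → Bool) where

    -- As f may depend on all of y and g on all of x, only the row coordinates
    -- read by f and the column coordinates read by g mix rows and columns;
    -- summing over their values separates the two.
    factorise : ∀ (D : List A) (cov : ∀ {d} → d ∈ D → d ∈ X ⊎ d ∈ Y)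
      (f : Assignment n Y → Tensor F n D) (g : Assignment n X → Tensor F n D) →
      (∀ y → DependsOn κ true (f y)) → (∀ x → DependsOn κ false (g x)) →
      Factorisation (λ x y → f y (assemble D cov x y) * g x (assemble D cov x y)) (n ^ cost κ D cov)
    factorise [] cov f g f-dep g-dep =
      factorisation-cong (λ _ _ → *-comm _ _) (factorisation-outer (λ x → g x []) (λ y → f y []))
    factorise (d ∷ D) cov f g f-dep g-dep with cov (here refl) | κ d in eq
    -- The sum is over the value `k` of this coordinate, and the indicator `δ`, a function of the
    -- row alone, selects the actual value. The unit `1#` only fills the column slot of
    -- `factorisation-scale`.
    ... | inj₁ p | true =
      factorisation-cong
        (λ x y → sum-pick (λ k → δ (All.lookup x p) k * 1#) (λ k → f y (k ∷ _) * g x (k ∷ _)) (All.lookup x p)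
          (≈-trans (*-identityʳ _) (δ-refl (All.lookup x p))) (λ a≢k → ≈-trans (*-identityʳ _) (δ-≢ a≢k)))
        (factorisation-sum n λ k → factorisation-scale (λ x → δ (All.lookup x p) k) (const 1#)
          (factorise D (cov ∘ there) (λ y z → f y (k ∷ z)) (λ x z → g x (k ∷ z))
            (λ y z z′ h → f-dep y _ _ (const refl , h)) (λ x z z′ h → g-dep x _ _ (const refl , h))))
    ... | inj₂ p | false =
      factorisation-cong
        (λ x y → sum-pick (λ k → 1# * δ (All.lookup y p) k) (λ k → f y (k ∷ _) * g x (k ∷ _)) (All.lookup y p)
          (≈-trans (*-identityˡ _) (δ-refl (All.lookup y p))) (λ a≢k → ≈-trans (*-identityˡ _) (δ-≢ a≢k)))
        (factorisation-sum n λ k → factorisation-scale (const 1#) (λ y → δ (All.lookup y p) k)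
          (factorise D (cov ∘ there) (λ y z → f y (k ∷ z)) (λ x z → g x (k ∷ z))
            (λ y z z′ h → f-dep y _ _ (const refl , h)) (λ x z z′ h → g-dep x _ _ (const refl , h))))
    -- The first tensor must not mention the row value `All.lookup x p`. As it does not read this
    -- coordinate, the default `a₀` can stand there instead.
    ... | inj₁ p | false =
      factorisation-cong
        (λ x y → *-congʳ (f-dep y _ _ ((λ e → contradiction (trans (sym eq) e) λ ()) , Agree-refl κ true _)))
        (factorise D (cov ∘ there) (λ y z → f y (a₀ ∷ z)) (λ x z → g x (All.lookup x p ∷ z))
          (λ y z z′ h → f-dep y _ _ (const refl , h)) (λ x z z′ h → g-dep x _ _ (const refl , h)))
    ... | inj₂ p | true =
      factorisation-cong
        (λ x y → *-congˡ (g-dep x _ _ ((λ e → contradiction (trans (sym eq) e) λ ()) , Agree-refl κ false _)))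
        (factorise D (cov ∘ there) (λ y z → f y (All.lookup y p ∷ z)) (λ x z → g x (a₀ ∷ z))
          (λ y z z′ h → f-dep y _ _ (const refl , h)) (λ x z z′ h → g-dep x _ _ (const refl , h)))

-- Components as intervals

sum-⊆ : ∀ {A : Set} (h : A → ℕ) {xs ys} → Unique xs → xs ⊆ ys → ℕ.sum (map h xs) ≤ ℕ.sum (map h ys)
sum-⊆ h {[]}     _           _  = z≤n
sum-⊆ h {x ∷ xs} (x∉ ∷ xs!) sub with as , bs , refl ← ∈-∃++ (sub (here refl)) =
  ℕ.≤-trans (ℕ.+-monoʳ-≤ (h x) (sum-⊆ h xs! sub′))
            (ℕ.≤-reflexive (sym (ℕ.sum-↭ (map⁺ h (shift x as bs)))))
  where
  sub′ : xs ⊆ as ++ bs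
  sub′ y∈ with ∈-resp-↭ (shift x as bs) (sub (there y∈))
  ... | here refl = ⊥-elim (All.lookup x∉ y∈ refl)
  ... | there y∈′ = y∈′

length-⊆ : ∀ {A : Set} {xs ys : List A} → Unique xs → xs ⊆ ys → length xs ≤ length ys
length-⊆ {xs = xs} {ys} xs! sub = subst₂ _≤_ (count xs) (count ys) (sum-⊆ (λ _ → 1) xs! sub)
  where
  count : ∀ {A : Set} (zs : List A) → ℕ.sum (map (λ _ → 1) zs) ≡ length zs
  count []       = refl
  count (_ ∷ zs) = cong suc (count zs)

pred<id : ∀ i → pred i ℤ.< i
pred<id i = ℤ.i≤pred[j]⇒i<j ℤ.≤-refl

-- With `i = lo + m` these are the edges `k` with `lo < k ≤ lo + m`, that is, the path from vertex
-- `lo` to vertex `lo + m`.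
interval : Edge → ℕ → List Edge
interval i zero    = []
interval i (suc m) = i ∷ interval (pred i) m

pred-+suc : ∀ lo m → pred (lo ℤ.+ + suc m) ≡ lo ℤ.+ + m
pred-+suc lo m = sym (ℤ.+-pred lo (+ suc m))

∈-interval⁺ : ∀ lo m {k} → lo ℤ.< k → k ℤ.≤ lo ℤ.+ + m → k ∈ interval (lo ℤ.+ + m) m
∈-interval⁺ lo zero    lo<k k≤ =
  ⊥-elim (ℤ.<⇒≱ lo<k (subst (_ ℤ.≤_) (ℤ.+-identityʳ lo) k≤))
∈-interval⁺ lo (suc m) {k} lo<k k≤ with k ℤ.≟ lo ℤ.+ + suc m
... | yes eq = here eq
... | no ne  = there (subst (λ j → k ∈ interval j m) (sym (pred-+suc lo m))
  (∈-interval⁺ lo m lo<k (subst (k ℤ.≤_) (pred-+suc lo m) (ℤ.i<j⇒i≤pred[j] (ℤ.≤∧≢⇒< k≤ ne)))))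

interval-≤ : ∀ i m {k} → k ∈ interval i m → k ℤ.≤ i
interval-≤ i (suc m) (here refl) = ℤ.≤-refl
interval-≤ i (suc m) (there k∈)  = ℤ.<⇒≤ (ℤ.i≤pred[j]⇒i<j (interval-≤ (pred i) m k∈))

interval-> : ∀ lo m {k} → k ∈ interval (lo ℤ.+ + m) m → lo ℤ.< k
interval-> lo (suc m) (here refl) =
  subst (ℤ._< lo ℤ.+ + suc m) (ℤ.+-identityʳ lo) (ℤ.+-monoʳ-< lo (ℤ.+<+ (s≤s z≤n)))
interval-> lo (suc m) (there k∈)  = interval-> lo m (subst (λ j → _ ∈ interval j m) (pred-+suc lo m) k∈)

interval! : ∀ i m → Unique (interval i m)
interval! i zero    = []
interval! i (suc m) =
  All.tabulate (λ k∈ eq → ℤ.<-irrefl (sym eq) (ℤ.i≤pred[j]⇒i<j (interval-≤ (pred i) m k∈))) ∷ interval! (pred i) m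

length-interval : ∀ i m → length (interval i m) ≡ m
length-interval i zero    = refl
length-interval i (suc m) = cong suc (length-interval (pred i) m)

-- The sign `false` asks consecutive edges to differ in colour, so the satisfied links are the cut
-- interior vertices of the path.
chain : ∀ i m → SignedTree (interval i (suc m))
chain i zero    = root i
chain i (suc m) = link i (here refl) false (chain (pred i) m)

-- The two edges at the vertex `v` carry the names `v` and `sucℤ v`.
cut : (Edge → Bool) → Vertex → Bool
cut s v = s v xor s (sucℤ v)

-- Summing over the ends of all edges meets every interior vertex twice. The extra `h i` makes the
-- induction work: once the path is prolonged, its top end becomes interior, and the new edge adds
-- the second copy.
twice-chain≤ : ∀ s (h : Vertex → ℕ) i m →
  (∀ {e} → e ∈ interval i (suc m) → pred e ∈ interval i (suc m) → h (pred e) ≡ bit (cut s (pred e))) →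
  2 ℕ.* satisfied (chain i m) s ℕ.+ h i ≤ ℕ.sum (map (λ e → h (pred e) ℕ.+ h e) (interval i (suc m)))
twice-chain≤ s h i zero    eq = ℕ.≤-trans (ℕ.m≤n+m (h i) (h (pred i))) (ℕ.m≤m+n _ 0)
twice-chain≤ s h i (suc m) eq = begin
  2 ℕ.* (bit (s i xor (s (pred i) xor false)) ℕ.+ S) ℕ.+ h i  ≡⟨ cong (λ k → 2 ℕ.* (k ℕ.+ S) ℕ.+ h i) link-cut ⟩
  2 ℕ.* (p ℕ.+ S) ℕ.+ h i                                     ≡⟨ rearrange p S (h i) ⟩
  p ℕ.+ h i ℕ.+ (2 ℕ.* S ℕ.+ p)                                 ≤⟨ ℕ.+-monoʳ-≤ (p ℕ.+ h i) (twice-chain≤ s h (pred i) m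
                                                              (λ e∈ e′∈ → eq (there e∈) (there e′∈))) ⟩
  p ℕ.+ h i ℕ.+ ℕ.sum (map (λ e → h (pred e) ℕ.+ h e) (interval (pred i) (suc m))) ∎
  where
  open ℕ.≤-Reasoning
  p = h (pred i)
  S = satisfied (chain (pred i) m) s
  xor-swap : ∀ a b → a xor (b xor false) ≡ b xor a
  xor-swap false false = refl
  xor-swap false true  = refl
  xor-swap true  false = refl
  xor-swap true  true  = refl
  link-cut : bit (s i xor (s (pred i) xor false)) ≡ p
  link-cut = trans (cong bit (trans (xor-swap (s i) (s (pred i)))
                                    (cong (λ j → s (pred i) xor s j) (sym (ℤ.suc-pred i)))))
                   (sym (eq (here refl) (there (here refl))))
  rearrange : ∀ p S q → 2 ℕ.* (p ℕ.+ S) ℕ.+ q ≡ p ℕ.+ q ℕ.+ (2 ℕ.* S ℕ.+ p)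
  rearrange = solve 3 (λ p S q → con 2 :* (p :+ S) :+ q := p :+ q :+ (con 2 :* S :+ p)) refl
    where open +-*-Solver

module _ (G : Subgraph) where
  open Subgraph G

  JoinedBy : Vertex → Vertex → Set
  JoinedBy v w = ∀ {k} → (v ℤ.< k × k ℤ.≤ w) ⊎ (w ℤ.< k × k ℤ.≤ v) → k ∈ E

  between-pred : ∀ {e k} → pred e ℤ.< k → k ℤ.≤ e → k ≡ e
  between-pred {e} p<k k≤e = ℤ.≤-antisym k≤e (subst (ℤ._≤ _) (ℤ.suc-pred e) (ℤ.i<j⇒suc[i]≤j p<k))

  step-joined : ∀ {v u} → (v , u) ∈ D G → JoinedBy v u
  step-joined d∈ with find (∈-concatMap⁻ directions {xs = E} d∈)
  ... | e , e∈E , here refl = λ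
    { (inj₁ (p<k , k≤e)) → subst (_∈ E) (sym (between-pred p<k k≤e)) e∈E
    ; (inj₂ (e<k , k≤p)) → ⊥-elim (ℤ.<⇒≱ e<k (ℤ.≤-trans k≤p (ℤ.<⇒≤ (pred<id e)))) }
  ... | e , e∈E , there (here refl) = λ
    { (inj₂ (p<k , k≤e)) → subst (_∈ E) (sym (between-pred p<k k≤e)) e∈E
    ; (inj₁ (e<k , k≤p)) → ⊥-elim (ℤ.<⇒≱ e<k (ℤ.≤-trans k≤p (ℤ.<⇒≤ (pred<id e)))) }

  -- An edge between `v` and `w` lies between `v` and `u` or between `u` and `w`, wherever the next
  -- vertex `u` of the walk is.
  connected-joined : ∀ {v w} → Connected G v w → JoinedBy v w
  connected-joined Star.ε (inj₁ (v<k , k≤v)) = ⊥-elim (ℤ.<⇒≱ v<k k≤v)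
  connected-joined Star.ε (inj₂ (v<k , k≤v)) = ⊥-elim (ℤ.<⇒≱ v<k k≤v)
  connected-joined (_◅_ {j = u} d c) {k} bet with k ℤ.≤? u | bet
  ... | yes k≤u | inj₁ (v<k , _)   = step-joined d (inj₁ (v<k , k≤u))
  ... | yes k≤u | inj₂ (w<k , _)   = connected-joined c (inj₂ (w<k , k≤u))
  ... | no k≰u  | inj₁ (_ , k≤w)   = connected-joined c (inj₁ (ℤ.≰⇒> k≰u , k≤w))
  ... | no k≰u  | inj₂ (_ , k≤v)   = step-joined d (inj₂ (ℤ.≰⇒> k≰u , k≤v))

  record Enclosure (v : Vertex) (C : List Edge) : Set where
    field
      lo hi : Vertex
      lo≤v  : lo ℤ.≤ v
      v≤hi  : v ℤ.≤ hi
      full  : ∀ {k} → lo ℤ.< k → k ℤ.≤ hi → k ∈ E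
      inside : ∀ {i} → i ∈ C → lo ℤ.< i × i ℤ.≤ hi

  -- The interval starts empty at `v` and is enlarged whenever an edge `i` falls outside;
  -- `JoinedBy v i` fills the gap.
  enclose : ∀ v C → (∀ {i} → i ∈ C → i ∈ E × JoinedBy v i) → Enclosure v C
  enclose v [] _ = record
    { lo = v ; hi = v ; lo≤v = ℤ.≤-refl ; v≤hi = ℤ.≤-refl
    ; full = λ v<k k≤v → ⊥-elim (ℤ.<⇒≱ v<k k≤v) ; inside = λ () }
  enclose v (i ∷ C) joined with enclose v C (joined ∘ there) | i ℤ.≤? v | joined (here refl)
  ... | record { lo = lo ; hi = hi ; lo≤v = lo≤v ; v≤hi = v≤hi ; full = full ; inside = inside } | yes i≤v | i∈E , v~i
    with lo ℤ.≤? pred i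
  ... | yes lo≤p = record
    { lo = lo ; hi = hi ; lo≤v = lo≤v ; v≤hi = v≤hi ; full = full
    ; inside = λ { (here refl) → ℤ.≤-<-trans lo≤p (pred<id i) , ℤ.≤-trans i≤v v≤hi ; (there j∈) → inside j∈ } }
  ... | no lo≰p = record
    { lo = pred i ; hi = hi ; lo≤v = ℤ.≤-trans (ℤ.<⇒≤ (pred<id i)) i≤v ; v≤hi = v≤hi ; full = full′
    ; inside = λ { (here refl) → pred<id i , ℤ.≤-trans i≤v v≤hi
                 ; (there j∈) → ℤ.<-trans (ℤ.≰⇒> lo≰p) (proj₁ (inside j∈)) , proj₂ (inside j∈) } }
    where
    full′ : ∀ {k} → pred i ℤ.< k → k ℤ.≤ hi → k ∈ E
    full′ {k} p<k k≤hi with k ℤ.≤? i | k ℤ.≤? v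
    -- Below `v`, the vertex `i` is the near end of the edge `i`, so this edge is not between `v`
    -- and `i` and has to come from `i∈E`.
    ... | yes k≤i | _       = subst (_∈ E) (sym (between-pred p<k k≤i)) i∈E
    ... | no k≰i  | yes k≤v = v~i (inj₂ (ℤ.≰⇒> k≰i , k≤v))
    ... | no k≰i  | no k≰v  = full (ℤ.≤-<-trans lo≤v (ℤ.≰⇒> k≰v)) k≤hi
  enclose v (i ∷ C) joined
      | record { lo = lo ; hi = hi ; lo≤v = lo≤v ; v≤hi = v≤hi ; full = full ; inside = inside } | no i≰v | i∈E , v~i
    with i ℤ.≤? hi
  ... | yes i≤hi = record
    { lo = lo ; hi = hi ; lo≤v = lo≤v ; v≤hi = v≤hi ; full = full
    ; inside = λ { (here refl) → ℤ.≤-<-trans lo≤v (ℤ.≰⇒> i≰v) , i≤hi ; (there j∈) → inside j∈ } }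
  ... | no i≰hi = record
    { lo = lo ; hi = i ; lo≤v = lo≤v ; v≤hi = ℤ.<⇒≤ (ℤ.≰⇒> i≰v) ; full = full′
    ; inside = λ { (here refl) → ℤ.≤-<-trans lo≤v (ℤ.≰⇒> i≰v) , ℤ.≤-refl
                 ; (there j∈) → proj₁ (inside j∈) , ℤ.≤-trans (proj₂ (inside j∈)) (ℤ.<⇒≤ (ℤ.≰⇒> i≰hi)) } }
    where
    full′ : ∀ {k} → lo ℤ.< k → k ℤ.≤ i → k ∈ E
    full′ {k} lo<k k≤i with k ℤ.≤? v
    ... | yes k≤v = full lo<k (ℤ.≤-trans k≤v v≤hi)
    ... | no k≰v  = v~i (inj₁ (ℤ.≰⇒> k≰v , k≤i))

  component⊆interval : ∀ {v C} → IsComponentEdges G v C →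
    ∃[ i ] ∃[ m ] length C ≤ m × interval i m ⊆ E
  component⊆interval {v} {C} (C! , C⇔) = lo ℤ.+ + m , m
    , subst (length C ≤_) (length-interval _ m) (length-⊆ C! λ i∈ →
        ∈-interval⁺ lo m (proj₁ (inside i∈)) (subst (_ ℤ.≤_) (sym lo+m) (proj₂ (inside i∈))))
    , λ k∈ → full (interval-> lo m k∈) (subst (_ ℤ.≤_) lo+m (interval-≤ _ m k∈))
    where
    enclosure : Enclosure v C
    enclosure = enclose v C λ i∈ → let i∈E , c = Equivalence.to (C⇔ _) i∈ in i∈E , connected-joined c
    open Enclosure enclosure
    m = ℤ.∣ hi ℤ.- lo ∣
    lo+m : lo ℤ.+ + m ≡ hi
    lo+m = trans (cong (λ z → lo ℤ.+ z) (ℤ.0≤i⇒+∣i∣≡i (ℤ.i≤j⇒0≤j-i (ℤ.≤-trans lo≤v v≤hi))))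
      (trans (ℤ.+-comm lo _) (trans (ℤ.+-assoc hi _ lo) (trans
         (cong (λ z → hi ℤ.+ z) (ℤ.+-inverseˡ lo)) (ℤ.+-identityʳ hi))))

-- Orientations and the cost of a colouring

-- An edge is named after its larger end.
edge : DEdge → Edge
edge (v , w) = v ℤ.⊔ w

edge-pred : ∀ i → edge (pred i , i) ≡ i
edge-pred i = ℤ.i≤j⇒i⊔j≡j (ℤ.<⇒≤ (pred<id i))

edge-pred′ : ∀ i → edge (i , pred i) ≡ i
edge-pred′ i = ℤ.i≥j⇒i⊔j≡i (ℤ.<⇒≤ (pred<id i))

edge-toward : ∀ v b → edge (toward v b) ≡ (if b then sucℤ v else v)
edge-toward v true  = ℤ.i≤j⇒i⊔j≡j (ℤ.i≤suc[i] v)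
edge-toward v false = edge-pred′ v

colour-toward : ∀ (s : Edge → Bool) v b → s (edge (toward v b)) ≡ (if b then s (sucℤ v) else s v)
colour-toward s v true  = cong s (edge-toward v true)
colour-toward s v false = cong s (edge-toward v false)

toward-injective : ∀ v {b b′} → toward v b ≡ toward v b′ → b ≡ b′
toward-injective v {true}  {true}  _  = refl
toward-injective v {false} {false} _  = refl
toward-injective v {true}  {false} eq = ⊥-elim (toward-not v true eq)
toward-injective v {false} {true}  eq = ⊥-elim (toward-not v false eq)

-- At a vertex where s changes, the edge coloured true is put into J and the
-- edge coloured false into I.
orient : (Edge → Bool) → Vertex → Bool
orient s v = if cut s v then s v else true

module _ (G : Subgraph) where
  open Subgraph G

  orientation : (Edge → Bool) → 𝒫 (V₂ G)
  orientation s = All.tabulate (λ {v} _ → orient s v)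

  V₁∩V₂ : ∀ {v} → v ∈ V₁ G → v ∉ V₂ G
  V₁∩V₂ v∈₁ v∈₂ = contradiction
    (trans (sym (proj₂ (∈-filter⁻ (λ v → degree G v ℕ.≟ 1) {xs = V} v∈₁)))
                (proj₂ (∈-filter⁻ (λ v → degree G v ℕ.≟ 2) {xs = V} v∈₂))) λ ()

  ∈-I-orientation : ∀ s {v b} → toward v b ∈ I (orientation s) → v ∈ V₂ G × b ≡ orient s v
  ∈-I-orientation s {v} {b} d∈ with v′ , v′∈ , eq ← I⁻ (orientation s) d∈
    with refl ← trans (sym (toward-tail v b)) (trans (cong proj₁ eq) (toward-tail v′ (All.lookup (orientation s) v′∈))) =
    v′∈ , trans (toward-injective v eq) (lookup-tabulate (λ {v} _ → orient s v) v′∈)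

  ∈-J-orientation : ∀ s {v b} → toward v b ∈ J (orientation s) → v ∈ V₂ G × b ≡ not (orient s v)
  ∈-J-orientation s {v} {b} d∈ with v′ , v′∈ , eq ← J⁻ (orientation s) d∈
    with refl ← trans (sym (toward-tail v b)) (trans (cong proj₁ eq)
      (toward-tail v′ (not (All.lookup (orientation s) v′∈)))) =
    v′∈ , trans (toward-injective v eq) (cong not (lookup-tabulate (λ {v} _ → orient s v) v′∈))

  ∈-D₁ : ∀ {v b} → toward v b ∈ D₁ G → v ∈ V₁ G
  ∈-D₁ {v} {b} d∈ = subst (_∈ V₁ G) (toward-tail v b)
    (proj₂ (∈-filter⁻ (λ d → proj₁ d ∈? V₁ G) {xs = D G} d∈))

  module _ (γ : 𝒫 (V₁ G)) where

    Rows Cols : (Edge → Bool) → DEdge → Set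
    Rows s d = d ∈ rowEdges G (orientation s) γ
    Cols s d = d ∈ colEdges G (orientation s) γ

    row⁻ : ∀ s {v b} → Rows s (toward v b) → (v ∈ V₂ G × b ≡ orient s v) ⊎ (v ∈ V₁ G × toward v b ∈ I γ)
    row⁻ s d∈ with ∈-++⁻ (I (orientation s)) d∈
    ... | inj₁ d∈I = inj₁ (∈-I-orientation s d∈I)
    ... | inj₂ d∈γ with d∈I , d∈D₁ ← ∈-filter⁻ _ {xs = I γ} d∈γ = inj₂ (∈-D₁ d∈D₁ , d∈I)

    col⁻ : ∀ s {v b} → Cols s (toward v b) → (v ∈ V₂ G × b ≡ not (orient s v)) ⊎ (v ∈ V₁ G × toward v b ∈ J γ)
    col⁻ s d∈ with ∈-++⁻ (J (orientation s)) d∈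
    ... | inj₁ d∈J = inj₁ (∈-J-orientation s d∈J)
    ... | inj₂ d∈γ with d∈J , d∈D₁ ← ∈-filter⁻ _ {xs = J γ} d∈γ = inj₂ (∈-D₁ d∈D₁ , d∈J)

    saving : (Edge → Bool) → Vertex → ℕ
    saving s v = if does (v ∈? V₂ G) then bit (cut s v) else 0

    charge-not : ∀ {P Q P′ Q′ : Set} (o : P ⊎ Q) (o′ : P′ ⊎ Q′) k → (P → Q′ → ⊥) → (Q → P′ → ⊥) →
                 bit (charge o k) ℕ.+ bit (charge o′ (not k)) ≡ 1
    charge-not (inj₁ _) (inj₁ _) true  _ _ = refl
    charge-not (inj₁ _) (inj₁ _) false _ _ = refl
    charge-not (inj₂ _) (inj₂ _) true  _ _ = refl
    charge-not (inj₂ _) (inj₂ _) false _ _ = refl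
    charge-not (inj₁ p) (inj₂ q) k h _ = ⊥-elim (h p q)
    charge-not (inj₂ q) (inj₁ p) k _ h = ⊥-elim (h q p)

    row₂ : ∀ s {v b} → v ∈ V₂ G → Rows s (toward v b) → b ≡ orient s v
    row₂ s v∈ d∈ with row⁻ s d∈
    ... | inj₁ (_ , eq)  = eq
    ... | inj₂ (v∈₁ , _) = ⊥-elim (V₁∩V₂ v∈₁ v∈)

    col₂ : ∀ s {v b} → v ∈ V₂ G → Cols s (toward v b) → b ≡ not (orient s v)
    col₂ s v∈ d∈ with col⁻ s d∈
    ... | inj₁ (_ , eq)  = eq
    ... | inj₂ (v∈₁ , _) = ⊥-elim (V₁∩V₂ v∈₁ v∈)

    row₁ : ∀ s {v b} → v ∉ V₂ G → Rows s (toward v b) → toward v b ∈ I γ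
    row₁ s v∉ d∈ with row⁻ s d∈
    ... | inj₁ (v∈ , _) = ⊥-elim (v∉ v∈)
    ... | inj₂ (_ , d∈I) = d∈I

    col₁ : ∀ s {v b} → v ∉ V₂ G → Cols s (toward v b) → toward v b ∈ J γ
    col₁ s v∉ d∈ with col⁻ s d∈
    ... | inj₁ (v∈ , _) = ⊥-elim (v∉ v∈)
    ... | inj₂ (_ , d∈J) = d∈J

    charge-cut : ∀ s {v b} → v ∈ V₂ G → cut s v ≡ true → (o : Rows s (toward v b) ⊎ Cols s (toward v b)) →
                 charge o (s (edge (toward v b))) ≡ false
    charge-cut s {v} {b} v∈ cut≡ (inj₁ d∈) = trans (colour-toward s v b)
      (row-false b (s v) (s (sucℤ v)) cut≡ (trans (row₂ s v∈ d∈) (cong (λ c → if c then s v else true) cut≡)))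
      where
      row-false : ∀ b p q → p xor q ≡ true → b ≡ p → (if b then q else p) ≡ false
      row-false _ false q     _ refl = refl
      row-false _ true  false _ refl = refl
    charge-cut s {v} {b} v∈ cut≡ (inj₂ d∈) = trans (cong not (colour-toward s v b))
      (col-false b (s v) (s (sucℤ v)) cut≡ (trans (col₂ s v∈ d∈) (cong (λ c → not (if c then s v else true)) cut≡)))
      where
      col-false : ∀ b p q → p xor q ≡ true → b ≡ not p → not (if b then q else p) ≡ false
      col-false _ false true _ refl = refl
      col-false _ true  q    _ refl = refl

    cut-not : ∀ s v → cut (not ∘ s) v ≡ cut s v
    cut-not s v with s v | s (sucℤ v)
    ... | false | false = refl
    ... | false | true  = refl
    ... | true  | false = refl
    ... | true  | true  = refl

    -- At a cut vertex of degree 2, `orient` makes the edge free for both colourings. At any other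
    -- vertex both colourings put it on the same side, and as its colour flips, exactly one of them
    -- is charged.
    charge-pair : ∀ s {v b} (o : Rows s (toward v b) ⊎ Cols s (toward v b))
      (o′ : Rows (not ∘ s) (toward v b) ⊎ Cols (not ∘ s) (toward v b)) →
      let k = s (edge (toward v b)) in bit (charge o k) ℕ.+ bit (charge o′ (not k)) ℕ.+ saving s v ≡ 1
    charge-pair s {v} {b} o o′ with v ∈? V₂ G
    ... | no v∉ = cong (ℕ._+ 0) (charge-not o o′ _
      (λ r c → I∩J V₁! γ (row₁ s v∉ r) (col₁ (not ∘ s) v∉ c))
      (λ c r → I∩J V₁! γ (row₁ (not ∘ s) v∉ r) (col₁ s v∉ c)))
      where
      V₁! : Unique (V₁ G)
      V₁! = Unique.filter⁺ (λ v → degree G v ℕ.≟ 1) V!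
    ... | yes v∈ with cut s v in eq
    ...   | true  = cong (ℕ._+ 1) (cong₂ (λ x y → bit x ℕ.+ bit y)
      (charge-cut s v∈ eq o) (charge-cut (not ∘ s) v∈ (trans (cut-not s v) eq) o′))
    ...   | false = cong (ℕ._+ 0) (charge-not o o′ _
      (λ r c → not-both (trans (row₂ s v∈ r) uncut) (trans (col₂ (not ∘ s) v∈ c) (cong not uncut′)))
      (λ c r → not-both (trans (row₂ (not ∘ s) v∈ r) uncut′) (trans (col₂ s v∈ c) (cong not uncut))))
      where
      uncut : orient s v ≡ true
      uncut = cong (λ c → if c then s v else true) eq
      uncut′ : orient (not ∘ s) v ≡ true
      uncut′ = cong (λ c → if c then not (s v) else true) (trans (cut-not s v) eq)
      not-both : b ≡ true → b ≡ false → ⊥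
      not-both refl ()

    colouring-cost : (Edge → Bool) → ℕ
    colouring-cost s = cost (s ∘ edge) (D G) (cover G (orientation s) γ)

    cost-pair : ∀ s E′ (let D′ = concatMap directions E′)
      (o  : ∀ {d} → d ∈ D′ → Rows s d ⊎ Cols s d)
      (o′ : ∀ {d} → d ∈ D′ → Rows (not ∘ s) d ⊎ Cols (not ∘ s) d) →
      cost (s ∘ edge) D′ o ℕ.+ cost (not ∘ s ∘ edge) D′ o′ ℕ.+
        ℕ.sum (map (λ e → saving s (pred e) ℕ.+ saving s e) E′) ≡ 2 ℕ.* length E′
    cost-pair s []       o o′ = refl
    cost-pair s (i ∷ E′) o o′ = trans
      (rearrange (bit (charge (o (here refl)) (s (edge (pred i , i)))))
                 (bit (charge (o′ (here refl)) (not (s (edge (pred i , i)))))) (saving s (pred i))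
                 (bit (charge (o (there (here refl))) (s (edge (i , pred i)))))
                 (bit (charge (o′ (there (here refl))) (not (s (edge (i , pred i)))))) (saving s i)
                 (cost (s ∘ edge) D′ (o ∘ there ∘ there)) _ _)
      (trans (cong₂ ℕ._+_ (cong₂ ℕ._+_ up (charge-pair s {i} {false} (o (there (here refl))) (o′ (there (here refl)))))
                        (cost-pair s E′ (o ∘ there ∘ there) (o′ ∘ there ∘ there)))
             (sym (ℕ.*-suc 2 (length E′))))
      where
      D′ = concatMap directions E′
      up : bit (charge (o (here refl)) (s (edge (pred i , i)))) ℕ.+
           bit (charge (o′ (here refl)) (not (s (edge (pred i , i))))) ℕ.+ saving s (pred i) ≡ 1
      up = go _ (cong (pred i ,_) (sym (ℤ.suc-pred i))) (o (here refl)) (o′ (here refl))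
        where
        -- The directed edge `(pred i , i)` is `toward (pred i) true` only up to a propositional
        -- equality, so `d` is generalised before matching on it.
        go : ∀ d → d ≡ toward (pred i) true → (x : Rows s d ⊎ Cols s d) (y : Rows (not ∘ s) d ⊎ Cols (not ∘ s) d) →
             bit (charge x (s (edge d))) ℕ.+ bit (charge y (not (s (edge d)))) ℕ.+ saving s (pred i) ≡ 1
        go _ refl = charge-pair s {pred i} {true}
      rearrange : ∀ a b c a′ b′ c′ x y z →
        (a ℕ.+ (a′ ℕ.+ x)) ℕ.+ (b ℕ.+ (b′ ℕ.+ y)) ℕ.+ ((c ℕ.+ c′) ℕ.+ z) ≡
        (a ℕ.+ b ℕ.+ c) ℕ.+ (a′ ℕ.+ b′ ℕ.+ c′) ℕ.+ (x ℕ.+ y ℕ.+ z)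
      rearrange = solve 9 (λ a b c a′ b′ c′ x y z →
        (a :+ (a′ :+ x)) :+ (b :+ (b′ :+ y)) :+ ((c :+ c′) :+ z) :=
        (a :+ b :+ c) :+ (a′ :+ b′ :+ c′) :+ (x :+ y :+ z)) refl
        where open +-*-Solver

    interior : ∀ {e} → e ∈ E → pred e ∈ E → pred e ∈ V₂ G
    interior {e} e∈ p∈ = ∈-filter⁺ (λ v → degree G v ℕ.≟ 2) (proj₁ (ends e∈))
      (ℕ.≤-antisym (degree≤2 G (pred e)) (length-⊆ {xs = e ∷ pred e ∷ []}
        (((λ eq → ℤ.<-irrefl (sym eq) (pred<id e)) ∷ []) ∷ [] ∷ [])
        λ { (here refl) → ∈-filter⁺ (incident? (pred e)) e∈ (inj₁ refl)
          ; (there (here refl)) → ∈-filter⁺ (incident? (pred e)) p∈ (inj₂ refl) }))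

    cost-chain : ∀ s {i m} → interval i (suc m) ⊆ E →
      colouring-cost s ℕ.+ colouring-cost (not ∘ s) ℕ.+ 2 ℕ.* satisfied (chain i m) s ≤ 2 ℕ.* length E
    cost-chain s {i} {m} ⊆E = ℕ.≤-trans
      (ℕ.+-monoʳ-≤ (colouring-cost s ℕ.+ colouring-cost (not ∘ s))
        (ℕ.≤-trans (ℕ.≤-trans (ℕ.m≤m+n _ _) (twice-chain≤ s (saving s) i m λ e∈ p∈ → saved (⊆E e∈) (⊆E p∈)))
          (sum-⊆ (λ e → saving s (pred e) ℕ.+ saving s e) (interval! i (suc m)) ⊆E)))
      (ℕ.≤-reflexive (cost-pair s E (cover G (orientation s) γ) (cover G (orientation (not ∘ s)) γ)))
      where
      saved : ∀ {e} → e ∈ E → pred e ∈ E → saving s (pred e) ≡ bit (cut s (pred e))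
      saved {e} e∈ p∈ = cong (λ c → if c then bit (cut s (pred e)) else 0)
        (dec-true (pred e ∈? V₂ G) (interior e∈ p∈))

    -- By averaging, since the two left-hand sides add up to at most `2 * length E`.
    cheap-colouring : ∀ s {i m} → interval i (suc m) ⊆ E →
      colouring-cost s ℕ.+ satisfied (chain i m) s ≤ length E ⊎
      colouring-cost (not ∘ s) ℕ.+ satisfied (chain i m) s ≤ length E
    cheap-colouring s {i} {m} ⊆E
      with colouring-cost s ℕ.+ satisfied (chain i m) s ℕ.≤? length E
         | colouring-cost (not ∘ s) ℕ.+ satisfied (chain i m) s ℕ.≤? length E
    ... | yes ≤E | _      = inj₁ ≤E
    ... | no _   | yes ≤E = inj₂ ≤E
    ... | no ≰E  | no ≰E′ = ⊥-elim (ℕ.<⇒≱ (ℕ.+-mono-< (ℕ.≰⇒> ≰E) (ℕ.≰⇒> ≰E′))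
      (subst₂ _≤_ (rearrange (colouring-cost s) (colouring-cost (not ∘ s)) (satisfied (chain i m) s))
        (cong (λ z → length E ℕ.+ z) (ℕ.+-identityʳ _)) (cost-chain s {i} {m} ⊆E)))
      where
      rearrange : ∀ a b c → a ℕ.+ b ℕ.+ 2 ℕ.* c ≡ (a ℕ.+ c) ℕ.+ (b ℕ.+ c)
      rearrange = solve 3 (λ a b c → a :+ b :+ con 2 :* c := (a :+ c) :+ (b :+ c)) refl
        where open +-*-Solver

-- Sums over splittings and rational arithmetic

same : ∀ {S} → 𝒫 S → 𝒫 S → Bool
same []          []          = true
same (true  ∷ α) (true  ∷ β) = same α β
same (false ∷ α) (false ∷ β) = same α β
same (true  ∷ α) (false ∷ β) = false
same (false ∷ α) (true  ∷ β) = false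

same⇒≡ : ∀ {S} (α β : 𝒫 S) → same α β ≡ true → α ≡ β
same⇒≡ []          []          _  = refl
same⇒≡ (true  ∷ α) (true  ∷ β) eq = cong (true ∷_) (same⇒≡ α β eq)
same⇒≡ (false ∷ α) (false ∷ β) eq = cong (false ∷_) (same⇒≡ α β eq)

-- Holds because `𝒫 S` is finite; it provides the ranks of all parts at once.
¬¬-∀𝒫 : ∀ {p} {S} (P : 𝒫 S → Set p) → (∀ α → ¬ ¬ P α) → ¬ ¬ (∀ α → P α)
¬¬-∀𝒫 {S = []}    P h k = h [] λ p → k λ { [] → p }
¬¬-∀𝒫 {S = _ ∷ _} P h k =
  ¬¬-∀𝒫 (λ α → P (true ∷ α)) (λ α → h (true ∷ α)) λ t →
  ¬¬-∀𝒫 (λ α → P (false ∷ α)) (λ α → h (false ∷ α)) λ f →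
  k λ { (true ∷ α) → t α ; (false ∷ α) → f α }

module _ {c ℓ : Level} (M : CommutativeMonoid c ℓ) where
  open CommutativeMonoid M renaming (refl to ≈-refl; trans to ≈-trans)
  open CommutativeSemigroupProperties commutativeSemigroup using (interchange)

  sum𝒫-ε : ∀ {S} → sum𝒫 rawMonoid {S} (λ _ → ε) ≈ ε
  sum𝒫-ε {[]}    = ≈-refl
  sum𝒫-ε {_ ∷ S} = ≈-trans (∙-cong (sum𝒫-ε {S}) (sum𝒫-ε {S})) (identityˡ ε)

  sum𝒫-∙ : ∀ {S} (f g : 𝒫 S → Carrier) →
           sum𝒫 rawMonoid (λ α → f α ∙ g α) ≈ sum𝒫 rawMonoid f ∙ sum𝒫 rawMonoid g
  sum𝒫-∙ {[]}    f g = ≈-refl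
  sum𝒫-∙ {_ ∷ S} f g = ≈-trans (∙-cong (sum𝒫-∙ (λ α → f (true ∷ α)) (λ α → g (true ∷ α)))
                                       (sum𝒫-∙ (λ α → f (false ∷ α)) (λ α → g (false ∷ α))))
                               (interchange _ _ _ _)

  sum𝒫-same : ∀ {S} (β : 𝒫 S) z → sum𝒫 rawMonoid (λ α → if same α β then z else ε) ≈ z
  sum𝒫-same []          z = ≈-refl
  sum𝒫-same {_ ∷ S} (true  ∷ β) z = ≈-trans (∙-cong (sum𝒫-same β z) (sum𝒫-ε {S})) (identityʳ z)
  sum𝒫-same {_ ∷ S} (false ∷ β) z = ≈-trans (∙-cong (sum𝒫-ε {S}) (sum𝒫-same β z)) (identityˡ z)

sum𝒫-mono-≤ : ∀ {S} {f g : 𝒫 S → ℕ} → (∀ α → f α ≤ g α) →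
              sum𝒫 ℕ.+-0-rawMonoid f ≤ sum𝒫 ℕ.+-0-rawMonoid g
sum𝒫-mono-≤ {[]}    h = h []
sum𝒫-mono-≤ {_ ∷ _} h = ℕ.+-mono-≤ (sum𝒫-mono-≤ λ α → h (true ∷ α)) (sum𝒫-mono-≤ λ α → h (false ∷ α))

fromℕ≃ : ∀ k → ℚ.toℚᵘ (fromℕ k) ℚᵘ.≃ mkℚᵘ (+ k) 0
fromℕ≃ k = ℚ.toℚᵘ-fromℚᵘ (mkℚᵘ (+ k) 0)

fromℕ-+ : ∀ a b → fromℕ (a ℕ.+ b) ≡ fromℕ a ℚ.+ fromℕ b
fromℕ-+ a b = ℚ.toℚᵘ-injective (begin
  ℚ.toℚᵘ (fromℕ (a ℕ.+ b))                   ≈⟨ fromℕ≃ (a ℕ.+ b) ⟩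
  mkℚᵘ (+ (a ℕ.+ b)) 0                        ≡⟨ cong₂ (λ x y → mkℚᵘ (x ℤ.+ y) 0)
                                                       (ℤ.*-identityʳ (+ a)) (ℤ.*-identityʳ (+ b)) ⟨
  mkℚᵘ (+ a) 0 ℚᵘ.+ mkℚᵘ (+ b) 0              ≈⟨ ℚᵘ.+-cong (fromℕ≃ a) (fromℕ≃ b) ⟨
  ℚ.toℚᵘ (fromℕ a) ℚᵘ.+ ℚ.toℚᵘ (fromℕ b)      ≈⟨ ℚ.toℚᵘ-homo-+ (fromℕ a) (fromℕ b) ⟨
  ℚ.toℚᵘ (fromℕ a ℚ.+ fromℕ b)                ∎)
  where open import Relation.Binary.Reasoning.Setoid ℚᵘ.≃-setoid

fromℕ-* : ∀ a b → fromℕ (a ℕ.* b) ≡ fromℕ a ℚ.* fromℕ b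
fromℕ-* a b = ℚ.toℚᵘ-injective (begin
  ℚ.toℚᵘ (fromℕ (a ℕ.* b))                   ≈⟨ fromℕ≃ (a ℕ.* b) ⟩
  mkℚᵘ (+ (a ℕ.* b)) 0                        ≡⟨ cong (λ x → mkℚᵘ x 0) (ℤ.pos-* a b) ⟩
  mkℚᵘ (+ a) 0 ℚᵘ.* mkℚᵘ (+ b) 0              ≈⟨ ℚᵘ.*-cong (fromℕ≃ a) (fromℕ≃ b) ⟨
  ℚ.toℚᵘ (fromℕ a) ℚᵘ.* ℚ.toℚᵘ (fromℕ b)      ≈⟨ ℚ.toℚᵘ-homo-* (fromℕ a) (fromℕ b) ⟨
  ℚ.toℚᵘ (fromℕ a ℚ.* fromℕ b)                ∎)
  where open import Relation.Binary.Reasoning.Setoid ℚᵘ.≃-setoid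

fromℕ-mono-≤ : ∀ {a b} → a ≤ b → fromℕ a ℚ.≤ fromℕ b
fromℕ-mono-≤ {a} {b} a≤b = ℚ.toℚᵘ-cancel-≤ (begin
  ℚ.toℚᵘ (fromℕ a)  ≃⟨ fromℕ≃ a ⟩
  mkℚᵘ (+ a) 0      ≤⟨ ℚᵘ.*≤* (ℤ.*-monoʳ-≤-nonNeg (+ 1) (ℤ.+≤+ a≤b)) ⟩
  mkℚᵘ (+ b) 0      ≃⟨ fromℕ≃ b ⟨
  ℚ.toℚᵘ (fromℕ b)  ∎)
  where open ℚᵘ.≤-Reasoning

fromℕ-nonNeg : ∀ k → ℚ.NonNegative (fromℕ k)
fromℕ-nonNeg k = ℚ.normalize-nonNeg k 1

fromℕ-pos : ∀ k .{{_ : NonZero k}} → ℚ.Positive (fromℕ k)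
fromℕ-pos k = ℚ.normalize-pos k 1

/-*-fromℕ : ∀ r N .{{_ : NonZero N}} → (+ r ℚ./ N) ℚ.* fromℕ N ≡ fromℕ r
/-*-fromℕ r (suc N) = ℚ.toℚᵘ-injective (begin
  ℚ.toℚᵘ ((+ r ℚ./ suc N) ℚ.* fromℕ (suc N))           ≈⟨ ℚ.toℚᵘ-homo-* (+ r ℚ./ suc N) (fromℕ (suc N)) ⟩
  ℚ.toℚᵘ (+ r ℚ./ suc N) ℚᵘ.* ℚ.toℚᵘ (fromℕ (suc N))   ≈⟨ ℚᵘ.*-cong (ℚ.toℚᵘ-fromℚᵘ (mkℚᵘ (+ r) N)) (fromℕ≃ (suc N)) ⟩
  mkℚᵘ (+ r) N ℚᵘ.* mkℚᵘ (+ suc N) 0                    ≈⟨ ℚᵘ.*≡* eq ⟩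
  mkℚᵘ (+ r) 0                                          ≈⟨ fromℕ≃ r ⟨
  ℚ.toℚᵘ (fromℕ r)                                      ∎)
  where
  open import Relation.Binary.Reasoning.Setoid ℚᵘ.≃-setoid
  eq : (+ r ℤ.* + suc N) ℤ.* + 1 ≡ + r ℤ.* (+ suc N ℤ.* + 1)
  eq = ℤ.*-assoc (+ r) (+ suc N) (+ 1)

sum𝒫-/ : ∀ {S} N .{{_ : NonZero N}} (m : 𝒫 S → ℕ) (q : 𝒫 S → ℚ) → (∀ α → q α ≡ + m α ℚ./ N) →
         sum𝒫 ℚ.+-0-rawMonoid q ℚ.* fromℕ N ≡ fromℕ (sum𝒫 ℕ.+-0-rawMonoid m)
sum𝒫-/ {[]}    N m q h = trans (cong (ℚ._* fromℕ N) (h [])) (/-*-fromℕ (m []) N)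
sum𝒫-/ {_ ∷ S} N m q h = trans (ℚ.*-distribʳ-+ (fromℕ N)
    (sum𝒫 ℚ.+-0-rawMonoid (λ α → q (true ∷ α))) (sum𝒫 ℚ.+-0-rawMonoid (λ α → q (false ∷ α))))
  (trans (cong₂ ℚ._+_ (sum𝒫-/ N (λ α → m (true ∷ α)) (λ α → q (true ∷ α)) (λ α → h (true ∷ α)))
                      (sum𝒫-/ N (λ α → m (false ∷ α)) (λ α → q (false ∷ α)) (λ α → h (false ∷ α))))
         (sym (fromℕ-+ (sum𝒫 ℕ.+-0-rawMonoid (λ α → m (true ∷ α))) _)))

scaled-≤ : ∀ a s m N L .{{_ : NonZero N}} → s ℚ.* fromℕ N ≡ fromℕ m → m ℕ.* a ≤ L ℕ.* N →
           fromℕ a ℚ.* s ℚ.≤ fromℕ L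
scaled-≤ a s m N L sN≡m ma≤LN = ℚ.*-cancelʳ-≤-pos (fromℕ N) {{fromℕ-pos N}} (begin
  fromℕ a ℚ.* s ℚ.* fromℕ N    ≡⟨ ℚ.*-assoc (fromℕ a) s (fromℕ N) ⟩
  fromℕ a ℚ.* (s ℚ.* fromℕ N)  ≡⟨ cong (fromℕ a ℚ.*_) sN≡m ⟩
  fromℕ a ℚ.* fromℕ m          ≡⟨ ℚ.*-comm (fromℕ a) (fromℕ m) ⟩
  fromℕ m ℚ.* fromℕ a          ≡⟨ fromℕ-* m a ⟨
  fromℕ (m ℕ.* a)              ≤⟨ fromℕ-mono-≤ ma≤LN ⟩
  fromℕ (L ℕ.* N)              ≡⟨ fromℕ-* L N ⟩
  fromℕ L ℚ.* fromℕ N          ∎)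
  where open ℚ.≤-Reasoning

scaled-nonNeg : ∀ s m N .{{_ : NonZero N}} → s ℚ.* fromℕ N ≡ fromℕ m → 0ℚ ℚ.≤ s
scaled-nonNeg s m N sN≡m = ℚ.*-cancelʳ-≤-pos (fromℕ N) {{fromℕ-pos N}} (begin
  0ℚ ℚ.* fromℕ N  ≡⟨ ℚ.*-zeroˡ (fromℕ N) ⟩
  0ℚ              ≤⟨ ℚ.nonNegative⁻¹ (fromℕ m) {{fromℕ-nonNeg m}} ⟩
  fromℕ m         ≡⟨ sN≡m ⟨
  s ℚ.* fromℕ N   ∎)
  where open ℚ.≤-Reasoning

-- For `l ≥ 1` this is the ceiling of log₂ `l`. Minimality turns the exponential bounds on satisfied
-- links into linear ones.
least-log₂ : ∀ l → ∃[ k ] l ≤ 2 ^ k × (∀ {m} → l ≤ 2 ^ m → k ≤ m)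
least-log₂ l = search l (ℕ.<⇒≤ (n<2^n l))
  where
  n<2^n : ∀ n → n ℕ.< 2 ^ n
  n<2^n zero    = s≤s z≤n
  n<2^n (suc n) = ℕ.≤-trans (s≤s (n<2^n n)) (ℕ.≤-trans
    (ℕ.+-monoˡ-≤ (2 ^ n) (ℕ.m^n>0 2 n)) (ℕ.+-monoʳ-≤ (2 ^ n) (ℕ.m≤m+n (2 ^ n) 0)))
  search : ∀ j → l ≤ 2 ^ j → ∃[ k ] l ≤ 2 ^ k × (∀ {m} → l ≤ 2 ^ m → k ≤ m)
  search zero    l≤ = 0 , l≤ , λ _ → z≤n
  search (suc j) l≤ with l ℕ.≤? 2 ^ j
  ... | yes l≤′ = search j l≤′
  ... | no l≰   = suc j , l≤ , λ {m} l≤m → ℕ.≰⇒> λ m≤j → l≰ (ℕ.≤-trans l≤m (ℕ.^-monoʳ-≤ 2 m≤j))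

^ℚ-bound : ∀ a (r : ℚ) L → 0ℚ ℚ.≤ r → fromℕ a ℚ.* r ℚ.≤ fromℕ L →
           ∀ q → fromℕ (a ^ q) ℚ.* (r ^ℚ q) ℚ.≤ fromℕ L ^ℚ q × 0ℚ ℚ.≤ r ^ℚ q
^ℚ-bound a r L 0≤r ar≤L zero    = ℚ.≤-refl , ℚ.nonNegative⁻¹ 1ℚ
^ℚ-bound a r L 0≤r ar≤L (suc q) with le , 0≤ ← ^ℚ-bound a r L 0≤r ar≤L q =
  (begin
    fromℕ (a ℕ.* a ^ q) ℚ.* (r ℚ.* r ^ℚ q)               ≡⟨ cong (ℚ._* (r ℚ.* r ^ℚ q)) (fromℕ-* a (a ^ q)) ⟩
    (fromℕ a ℚ.* fromℕ (a ^ q)) ℚ.* (r ℚ.* r ^ℚ q)       ≡⟨ interchange (fromℕ a) (fromℕ (a ^ q)) r (r ^ℚ q) ⟩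
    (fromℕ a ℚ.* r) ℚ.* (fromℕ (a ^ q) ℚ.* r ^ℚ q)       ≤⟨ ℚ.*-monoʳ-≤-nonNeg (fromℕ (a ^ q) ℚ.* r ^ℚ q)
                                                              {{nonNeg-ar}} ar≤L ⟩
    fromℕ L ℚ.* (fromℕ (a ^ q) ℚ.* r ^ℚ q)               ≤⟨ ℚ.*-monoˡ-≤-nonNeg (fromℕ L) {{fromℕ-nonNeg L}} le ⟩
    fromℕ L ℚ.* fromℕ L ^ℚ q                              ∎)
  , ℚ.nonNegative⁻¹ (r ℚ.* r ^ℚ q) {{ℚ.nonNeg*nonNeg⇒nonNeg r {{ℚ.nonNegative 0≤r}} (r ^ℚ q) {{ℚ.nonNegative 0≤}}}}
  where
  open ℚ.≤-Reasoning
  open CommutativeSemigroupProperties (CommutativeMonoid.commutativeSemigroup ℚ.*-1-commutativeMonoid) using (interchange)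
  nonNeg-ar : ℚ.NonNegative (fromℕ (a ^ q) ℚ.* r ^ℚ q)
  nonNeg-ar = ℚ.nonNeg*nonNeg⇒nonNeg (fromℕ (a ^ q)) {{fromℕ-nonNeg (a ^ q)}} (r ^ℚ q) {{ℚ.nonNegative 0≤}}

-- An integer exponent `k` above log₂ `l` suffices: `2 ^ p ≤ l ^ q ≤ 2 ^ (k * q)` gives `p ≤ k * q`,
-- and the assumed inequality is raised to the power `q`.
≼-log₂ : ∀ n .{{_ : NonZero n}} {k l L} {r : ℚ} → l ≤ 2 ^ k → 0ℚ ℚ.≤ r → fromℕ (n ^ k) ℚ.* r ℚ.≤ fromℕ L →
         n ^log₂ l · r ≼ L
≼-log₂ n {k} {l} {L} {r} l≤2^k 0≤r nr≤L p q 2^p≤l^q with le , 0≤ ← ^ℚ-bound (n ^ k) r L 0≤r nr≤L q =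
  ℚ.≤-trans (ℚ.*-monoʳ-≤-nonNeg (r ^ℚ q) {{ℚ.nonNegative 0≤}} (fromℕ-mono-≤ n^p≤)) le
  where
  p≤kq : p ≤ k ℕ.* q
  p≤kq = ℕ.≮⇒≥ λ kq<p → ℕ.<⇒≱ (ℕ.^-monoʳ-< 2 (s≤s (s≤s z≤n)) kq<p)
    (ℕ.≤-trans 2^p≤l^q (ℕ.≤-trans (ℕ.^-monoˡ-≤ q l≤2^k) (ℕ.≤-reflexive (ℕ.^-*-assoc 2 k q))))
  n^p≤ : n ^ p ≤ (n ^ k) ^ q
  n^p≤ = ℕ.≤-trans (ℕ.^-monoʳ-≤ n p≤kq) (ℕ.≤-reflexive (sym (ℕ.^-*-assoc n k q)))

-- The bound on ρ

pair : ∀ {n} {E : List Edge} → Assignment n (concatMap directions E) → Assignment (n ℕ.* n) E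
pair {E = []}    []          = []
pair {E = _ ∷ _} (a ∷ b ∷ x) = combine a b ∷ pair x

unpair-pair : ∀ {n} {E : List Edge} (x : Assignment n (concatMap directions E)) → unpair (pair {E = E} x) ≡ x
unpair-pair         {E = []}    []          = refl
unpair-pair {n = n} {E = _ ∷ _} (a ∷ b ∷ x) =
  cong₂ (λ (c , d) y → c ∷ d ∷ y) (Fin.remQuot-combine {n} a b) (unpair-pair x)

Agree-pair : ∀ {n} {s : Edge → Bool} {b} {E : List Edge} (x x′ : Assignment n (concatMap directions E)) →
             Agree (s ∘ edge) b x x′ → Agree s b (pair {E = E} x) (pair x′)
Agree-pair         {E = []}    []          []            _             = tt
Agree-pair {s = s} {b} {E = i ∷ _} (_ ∷ _ ∷ x) (_ ∷ _ ∷ x′) (h , h′ , hs) =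
  (λ eq → cong₂ combine (h (trans (cong s (edge-pred i)) eq)) (h′ (trans (cong s (edge-pred′ i)) eq)))
  , Agree-pair x x′ hs

Agree-not : ∀ {A : Set} {N} {κ : A → Bool} {b X} {x x′ : Assignment N X} →
            Agree (not ∘ κ) b x x′ → Agree κ (not b) x x′
Agree-not {x = []}    {[]}    _        = tt
Agree-not {x = _ ∷ _} {_ ∷ _} (h , hs) = (λ eq → h (trans (cong not eq) (Bool.not-involutive _))) , Agree-not hs

module Bound {c ℓ₁ ℓ₂ : Level} (F : HeytingField c ℓ₁ ℓ₂) {n : ℕ} .{{_ : NonZero n}} (G : Subgraph) (γ : 𝒫 (V₁ G)) where
  open HeytingField F using (Carrier; _≈_; _*_; 0#)
  open Subgraph G
  open Branching F using (ColouredProduct; Σproduct; decompose; module Decomposition)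
  open ColouredProduct
  open Ranks F
  open Flattening F using (factorise)
  open CommutativeRing R
    using (_+_; +-rawMonoid; +-commutativeMonoid; +-cong; *-comm; reflexive)
    renaming (sym to ≈-sym; trans to ≈-trans)

  Matrix : ∀ α → Tensor F n (D G) → Assignment n (rowEdges G α γ) → Assignment n (colEdges G α γ) → Carrier
  Matrix α = Mat F (rowEdges G α γ) (colEdges G α γ) (cover G α γ)

  -- The number `rank` is only an upper bound for the rank; `rank≤` says that the relative rank is
  -- at most `n ^ (- S)`.
  record Piece (B : Tensor F n (D G)) (S : ℕ) : Set (c ⊔ ℓ₁) where
    field
      α     : 𝒫 (V₂ G)
      rank  : ℕ
      rank≤ : rank ℕ.* n ^ S ≤ n ^ length E
      factorisation : Factorisation (Matrix α B) rank
  open Piece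

  flip : ∀ {A : Set} {N} {X : List A} → ColouredProduct N X → ColouredProduct N X
  flip π = record
    { colouring = not ∘ colouring π
    ; factor    = factor π ∘ not
    ; depends   = λ b x x′ h → depends π (not b) x x′ (Agree-not h)
    }

  a₀ : Fin n
  a₀ = Fin.fromℕ< (ℕ.>-nonZero⁻¹ n)

  cheap-piece : ∀ (π : ColouredProduct (n ℕ.* n) E) {S k} → S ≤ k →
                colouring-cost G γ (colouring π) ℕ.+ k ≤ length E → Piece (product π ∘ pair) S
  cheap-piece π {S} {k} S≤k h = record
    { α       = orientation G (colouring π)
    ; rank    = n ^ cost₀
    ; rank≤   = ℕ.≤-trans (ℕ.≤-reflexive (sym (ℕ.^-distribˡ-+-* n cost₀ S)))
                  (ℕ.^-monoʳ-≤ n (ℕ.≤-trans (ℕ.+-monoʳ-≤ cost₀ S≤k) h))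
    ; factorisation = factorise a₀ (colouring π ∘ edge) (D G) (cover G (orientation G (colouring π)) γ)
                  (λ _ → factor π true ∘ pair) (λ _ → factor π false ∘ pair)
                  (λ _ x x′ h → depends π true _ _ (Agree-pair x x′ h))
                  (λ _ x x′ h → depends π false _ _ (Agree-pair x x′ h))
    }
    where
    cost₀ = colouring-cost G γ (colouring π)

  Piece-cong : ∀ {B B′ S} → (∀ x → B′ x ≈ B x) → Piece B S → Piece B′ S
  Piece-cong eq p = record
    { α = α p ; rank = rank p ; rank≤ = rank≤ p
    ; factorisation = factorisation-cong (λ _ _ → eq _) (factorisation p) }

  piece : ∀ {i m S} → interval i (suc m) ⊆ E → (π : ColouredProduct (n ℕ.* n) E) →
          S ≤ satisfied (chain i m) (colouring π) → Piece (product π ∘ pair) S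
  piece {i} {m} ⊆E π S≤ with cheap-colouring G γ (colouring π) {i} {m} ⊆E
  ... | inj₁ h = cheap-piece π S≤ h
  -- Exchanging the two factors complements the colouring and leaves the product unchanged.
  ... | inj₂ h = Piece-cong (λ _ → *-comm _ _) (cheap-piece (flip π) S≤ h)

  -- The family `part` competes in the minimum over decompositions of `B`; by `bound≤` its relative
  -- ranks add up to at most `L / n ^ S`.
  record Grouping (B : Tensor F n (D G)) (S L : ℕ) : Set (c ⊔ ℓ₁) where
    field
      part   : 𝒫 (V₂ G) → Tensor F n (D G)
      bound  : 𝒫 (V₂ G) → ℕ
      sums   : ∀ x → B x ≈ sum𝒫 +-rawMonoid (λ α → part α x)
      factors : ∀ α → Factorisation (Matrix α (part α)) (bound α)
      bound≤ : sum𝒫 ℕ.+-0-rawMonoid bound ℕ.* n ^ S ≤ L ℕ.* n ^ length E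

  -- Each product goes into the part of its own `α` and contributes the zero tensor, with bound 0,
  -- to all others.
  group : ∀ {S} (πs : List (ColouredProduct (n ℕ.* n) E)) → All (λ π → Piece (product π ∘ pair) S) πs →
          Grouping (Σproduct πs ∘ pair) S (length πs)
  group {S} [] [] = record
    { part    = λ _ _ → 0#
    ; bound   = λ _ → 0
    ; sums    = λ _ → ≈-sym (sum𝒫-ε +-commutativeMonoid {V₂ G})
    ; factors = λ _ → factorisation-zero
    ; bound≤  = ℕ.≤-reflexive (cong (ℕ._* n ^ S) (sum𝒫-ε ℕ.+-0-commutativeMonoid {V₂ G}))
    }
  group {S} (π ∷ πs) (p ∷ ps) = record
    { part    = λ β x → (if same β (α p) then product π (pair x) else 0#) + part β x
    ; bound   = λ β → (if same β (α p) then rank p else 0) ℕ.+ bound β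
    ; sums    = λ x → ≈-trans (+-cong (≈-sym (sum𝒫-same +-commutativeMonoid (α p) (product π (pair x)))) (sums x))
                  (≈-sym (sum𝒫-∙ +-commutativeMonoid
                    (λ β → if same β (α p) then product π (pair x) else 0#) (λ β → part β x)))
    ; factors = λ β → factorisation-+ (head β) (factors β)
    ; bound≤  = ℕ.≤-trans (ℕ.≤-reflexive (trans (cong (ℕ._* n ^ S)
                    (trans (sum𝒫-∙ ℕ.+-0-commutativeMonoid (λ β → if same β (α p) then rank p else 0) bound)
                       (cong (ℕ._+ sum𝒫 ℕ.+-0-rawMonoid bound) (sum𝒫-same ℕ.+-0-commutativeMonoid (α p) (rank p)))))
                    (ℕ.*-distribʳ-+ (n ^ S) (rank p) (sum𝒫 ℕ.+-0-rawMonoid bound))))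
                  (ℕ.+-mono-≤ (rank≤ p) bound≤)
    }
    where
    open Grouping (group πs ps)
    head : ∀ β → Factorisation (Matrix β (λ x → if same β (α p) then product π (pair x) else 0#))
                               (if same β (α p) then rank p else 0)
    head β with same β (α p) in eq
    ... | false = factorisation-zero
    ... | true  rewrite same⇒≡ β (α p) eq = factorisation p

  N : ℕ
  N = n ^ length E

  instance
    N≢0 : NonZero N
    N≢0 = ℕ.m^n≢0 n (length E)

  relrkSum : ∀ {B S L} → Grouping B S L →
             ¬ ¬ (∃[ s ] IsRelrkSum F G γ B s × fromℕ (n ^ S) ℚ.* s ℚ.≤ fromℕ L)
  relrkSum {B} {S} {L} g k = ¬¬-∀𝒫 (λ α → ∃[ r ] IsRank F (Matrix α (part α)) r) (λ α → ¬¬rank (factors α)) given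
    where
    open Grouping g
    given : ¬ (∀ α → ∃[ r ] IsRank F (Matrix α (part α)) r)
    given r = k (s , (part , q , sums , (λ α → proj₁ (r α) , proj₂ (r α) , refl) , refl)
                , scaled-≤ (n ^ S) s ranks N L (sum𝒫-/ N (λ α → proj₁ (r α)) q (λ _ → refl)) ranks≤)
      where
      q : 𝒫 (V₂ G) → ℚ
      q α = + proj₁ (r α) ℚ./ N
      s = sum𝒫 ℚ.+-0-rawMonoid q
      ranks = sum𝒫 ℕ.+-0-rawMonoid (λ α → proj₁ (r α))
      ranks≤ : ranks ℕ.* n ^ S ≤ L ℕ.* N
      ranks≤ = ℕ.≤-trans (ℕ.*-monoˡ-≤ (n ^ S) (sum𝒫-mono-≤ λ α →
        rank≤size (factors α) (proj₂ (r α)))) bound≤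

  relrkSum-nonNeg : ∀ {B s} → IsRelrkSum F G γ B s → 0ℚ ℚ.≤ s
  relrkSum-nonNeg {s = s} (_ , q , _ , rk , s≡) =
    scaled-nonNeg s (sum𝒫 ℕ.+-0-rawMonoid (λ α → proj₁ (rk α))) N
      (trans (cong (ℚ._* fromℕ N) s≡) (sum𝒫-/ N (λ α → proj₁ (rk α)) q (λ α → proj₂ (proj₂ (rk α)))))

  grouping : ∀ (A : Tensor F n (D G)) {L i m S} → IsLsm F (flat F G A) L → interval i (suc m) ⊆ E →
             (∀ {k} → suc m ≤ 2 ^ k → S ≤ k) → Grouping A S L
  grouping A {i = i} {m} {S} isL ⊆E least = record
    { part    = part
    ; bound   = bound
    ; sums    = λ x → ≈-trans (reflexive (cong A (sym (unpair-pair {E = E} x))))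
                  (≈-trans (Decomposition.sums d (pair x)) (sums x))
    ; factors = factors
    ; bound≤  = ℕ.≤-trans bound≤ (ℕ.*-monoˡ-≤ (n ^ length E) (Decomposition.length≤ d))
    }
    where
    d = decompose (length E) (flat F G A) isL E! (chain i m) (interval! i (suc m)) ⊆E
    tree≤ : ∀ {k} → length (interval i (suc m)) ≤ 2 ^ k → S ≤ k
    tree≤ h = least (ℕ.≤-trans (ℕ.≤-reflexive (sym (length-interval i (suc m)))) h)
    pieces : All (λ π → Piece (product π ∘ pair) S) (Decomposition.terms d)
    pieces = All.map (λ {π} h → piece {i} {m} ⊆E π (tree≤ h)) (Decomposition.tree≤ d)
    grouped : Grouping (Σproduct (Decomposition.terms d) ∘ pair) S (length (Decomposition.terms d))
    grouped = group (Decomposition.terms d) pieces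
    open Grouping grouped

module _ {c ℓ₁ ℓ₂ : Level} (F : HeytingField c ℓ₁ ℓ₂) (n : ℕ) .{{_ : NonZero n}} (G : Subgraph) where
  open Subgraph G

  ρ-bound : ∀ (A : Tensor F n (D G)) {L l i m} {r : ℚ} → IsLsm F (flat F G A) L →
            l ≤ m → interval i m ⊆ E → Isρ F G A r → n ^log₂ l · r ≼ L
  -- Here `l = 0`, and no power of 2 is at most `0 ^ suc q`.
  ρ-bound A {m = zero} isL z≤n _ _ p (suc q) 2^p≤0 = ⊥-elim (ℕ.<⇒≱ (ℕ.m^n>0 2 p) 2^p≤0)
  ρ-bound A {L} {l} {i} {suc m} {r} isL l≤m ⊆E ((γ , isSum , minimal) , _) p q 2^p≤l^q =
    -- The splitting `γ` is one at which the maximum is attained, so `r` is a minimum for it and is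
    -- at most the sum `s` built from the formula.
    decidable-stable (fromℕ (n ^ p) ℚ.* (r ^ℚ q) ℚ.≤? fromℕ L ^ℚ q) λ ¬goal →
      Bound.relrkSum F {n} G γ (Bound.grouping F {n} G γ A {L} {i} {m} {S} isL ⊆E
        (λ h → least (ℕ.≤-trans l≤m h))) λ (s , isSum′ , ns≤L) →
        ¬goal (≼-log₂ n {S} {l} {L} {r} l≤2^S (Bound.relrkSum-nonNeg F {n} G γ isSum)
          (ℚ.≤-trans (ℚ.*-monoˡ-≤-nonNeg (fromℕ (n ^ S)) {{fromℕ-nonNeg (n ^ S)}} (minimal s isSum′))
            ns≤L) p q 2^p≤l^q)
    where
    S = proj₁ (least-log₂ l)
    l≤2^S = proj₁ (proj₂ (least-log₂ l))
    least = proj₂ (proj₂ (least-log₂ l))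

theorem5p11 : ∀ {c ℓ₁ ℓ₂} (F : HeytingField c ℓ₁ ℓ₂)
    (n : ℕ) .{{_ : NonZero n}}
    (G : Subgraph) → Subgraph.V G ≢ [] → NoIsolatedVertices G →
    (A : Tensor F n (D G)) →
    ∀ {L l : ℕ} {r : ℚ} →
    IsLsm F (flat F G A) L → Isℓ G l → Isρ F G A r →
    n ^log₂ l · r ≼ L
theorem5p11 F n G _ _ A isL ((v , C , _ , isC , refl) , _) isρ =
  let i , m , l≤m , ⊆E = component⊆interval G isC
  in ρ-bound F n G A isL l≤m ⊆E isρ
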